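{- Let $k$ and $\ell$ be coprime positive integers with $k$ odd, and write $q:=2^k$ and $Q:=2^\ell$. Write $R(X,Y):=(X+\alpha Y)^{Q+1}+(\beta Y)^{Q+1}$ with $\alpha,\beta\in\mathbb{F}_q^*$. Then the function $\psi\colon(x,y)\mapsto\bigl(R(x,y),R(y,x)\bigr)$ permutes $\mathbb{F}_q\times\mathbb{F}_q$ if and only if $\beta\ne\alpha+1$ and $u^Q=e^{Q-1}v$, where $$e:=(\alpha+1)^{2Q+2}+\beta^{2Q+2},$$ $$u:=(\alpha+1)^{2Q+2}+\alpha^{2Q+1}+\alpha+\alpha^Q\beta^{Q+1}+\beta^{2Q+2},$$ $$v:=(\alpha+1)^{2Q+2}+\alpha^{Q+2}+\alpha^Q+\alpha\beta^{Q+1}+\beta^{2Q+2}.$$ -}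

module Defs where

open import Algebra.Apartness.Bundles using (HeytingField; HeytingCommutativeRing)
open import Algebra.Bundles using (CommutativeRing)
open import Data.Fin.Base using (Fin)
open import Data.Nat.Base as ℕ using (ℕ)
open import Data.Product.Base using (_×_; _,_)
open import Data.Product.Relation.Binary.Pointwise.NonDependent using (Pointwise)
open import Function.Bundles using (Inverse)
open import Function.Definitions using (Bijective)
open import Level using (Level; _⊔_)
open import Relation.Binary.Core using (Rel)
import Relation.Binary.PropositionalEquality.Properties as ≡

-- A field is a HeytingField. Over a finite one both ≈ and # are decidable,
-- and # coincides with ≉, so this is the usual notion of a finite field;
-- IsHeytingField already excludes the zero ring.
module Field {c ℓ₁ ℓ₂ : Level} (F : HeytingField c ℓ₁ ℓ₂) where

  commutativeRing : CommutativeRing c ℓ₁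
  commutativeRing =
    HeytingCommutativeRing.commutativeRing (HeytingField.heytingCommutativeRing F)

  open CommutativeRing commutativeRing public
    using (Carrier; _≈_; _≉_; _+_; _*_; 0#; 1#; setoid; semiring)
  open import Algebra.Properties.Semiring.Exp semiring public using (_^_)

  HasOrder : ℕ → Set (c ⊔ ℓ₁)
  HasOrder n = Inverse setoid (≡.setoid (Fin n))

  _≈²_ : Rel (Carrier × Carrier) ℓ₁
  _≈²_ = Pointwise _≈_ _≈_

  Permutes² : (Carrier × Carrier → Carrier × Carrier) → Set (c ⊔ ℓ₁)
  Permutes² = Bijective _≈²_ _≈²_

  module _ (Q : ℕ) (α β : Carrier) where

    R : Carrier → Carrier → Carrier
    R x y = (x + α * y) ^ (Q ℕ.+ 1) + (β * y) ^ (Q ℕ.+ 1)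

    ψ : Carrier × Carrier → Carrier × Carrier
    ψ (x , y) = R x y , R y x

    e : Carrier
    e = (α + 1#) ^ (2 ℕ.* Q ℕ.+ 2) + β ^ (2 ℕ.* Q ℕ.+ 2)

    u : Carrier
    u = (α + 1#) ^ (2 ℕ.* Q ℕ.+ 2) + α ^ (2 ℕ.* Q ℕ.+ 1) + α
      + α ^ Q * β ^ (Q ℕ.+ 1) + β ^ (2 ℕ.* Q ℕ.+ 2)

    v : Carrier
    v = (α + 1#) ^ (2 ℕ.* Q ℕ.+ 2) + α ^ (Q ℕ.+ 2) + α ^ Q
      + α * β ^ (Q ℕ.+ 1) + β ^ (2 ℕ.* Q ℕ.+ 2)

{-# OPTIONS --safe #-}

-- Write σ x = x ^ Q and N x = σ x * x. As k is odd and coprime to ℓ, N is a bijection, the fixed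
-- field of σ is 𝔽₂, and σ x + x = 1 has no solution. Put δ = N (α + 1) + N β; then e = δ², and
-- δ = 0 just when β = α + 1. If δ ≠ 0, linear changes of coordinates on both sides turn ψ into
--   Φ κ : (x , s) ↦ (N x + κ * N s , σ x * s + x * σ s + N s),
-- where the condition on u, v and e becomes σ κ = κ. On the points (p , 1) the ratio of the two
-- components of Φ κ is f p = p + v p with v p = (p² + p + κ) / (σ p + p + 1), and f (p + 1) = f p + 1.
--
-- If f is bijective, the sums of σ (f p) + f p and of σ p + p over the p of trace 1 agree, because
-- σ t + t is 1-periodic. Hence σ fixes the sum of v p over the p of trace 1. This sum is s₁ + κ * s₀
-- where σ fixes s₁ and s₀ is the sum of 1 / x over the x of trace 1, which is 1; so σ κ = κ.
-- Conversely, if σ κ = κ, a collision of Φ κ yields a solution of σ x + x = 1.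
module Submission where

open import Defs
open import Algebra.Apartness.Bundles using (HeytingField)
open import Algebra.Bundles using (CommutativeMonoid; CommutativeRing; RawRing)
open import Algebra.Solver.Ring.AlmostCommutativeRing using (fromCommutativeSemiring; _-Raw-AlmostCommutative⟶_)
open import Data.Bool.Base using (Bool; true; false; _∧_; _xor_)
import Data.Bool.Properties as Bool
open import Data.Empty using (⊥-elim)
open import Data.Fin.Base using (Fin; zero; suc; toℕ; fromℕ; inject₁; combine; remQuot; punchOut)
open import Data.Fin.Permutation using (permutation)
open import Data.Fin.Properties using (punchOut-injective; injective⇒≤; remQuot-combine; combine-remQuot; toℕ-fromℕ; toℕ-inject₁; suc-injective) renaming (_≟_ to _≟ᶠ_; any? to anyᶠ?)
open import Data.Maybe.Base using (map)
open import Data.Nat.Base as ℕ using (ℕ; zero; suc; _<_; _∸_)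
open import Data.Nat.Coprimality as ℕ using (Coprime)
open import Data.Nat.Divisibility using (_∣_; _∤_; divides; divides-refl; ∣-trans)
open import Data.Nat.GCD using (module Bézout)
open import Data.Nat.Primality using (prime?; prime⇒irreducible)
import Data.Nat.Properties as ℕ
open import Data.Product.Base using (_×_; _,_; proj₁; proj₂; ∃)
open import Data.Product.Relation.Binary.Pointwise.NonDependent using (×-setoid)
open import Data.Sum.Base using (_⊎_; inj₁; inj₂; [_,_])
open import Function.Base using (_∘_; id)
open import Function.Bundles using (_⇔_; mk⇔; Inverse)
open import Function.Definitions using (Bijective; Congruent; Injective; StrictlySurjective)
open import Level using (Level)
open import Relation.Binary.Bundles using (Setoid)
open import Relation.Binary.Definitions using (Decidable; _Respects_)
open import Relation.Binary.PropositionalEquality as ≡ using (_≡_; _≢_)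
open import Relation.Nullary using (Dec; yes; no; ¬_; contradiction)
open import Relation.Nullary.Decidable using (dec⇒maybe; from-yes; map′)
open import Relation.Unary using (Pred)
import Relation.Unary as U

-- The coordinate change hinges on some `b` with `σ b + b = σ a′ + a`, where `a = (α + 1) / δ` and
-- `a′ = σ (α + 1) / δ`. Such `b` exists only if the right side has trace 0; otherwise only
-- `σ b + b = σ a′ + a + 1` is solvable. In that case there is no normal form of this kind, and both
-- sides of the equivalence are refuted directly: the condition would solve `σ y + y = 1`, and an
-- off-diagonal point collides with a diagonal one, because `R y y = δ * norm y` takes every value.
-- In the good case the parameter of the normal form is `norm β / δ² + b² + b`. The condition says
-- that it is fixed by `σ`, because `u / e` and `v / e` are the values of `1 + z² + z + norm β / δ²`
-- at `z = a′` and `z = a`. The restriction to trace 1 in the necessity argument is essential: over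
-- the whole field every 1-periodic function sums to 0, so that sum would not see `κ`. The elements
-- of trace 1 form a `σ`-stable set with exactly one member of each pair `p`, `p + 1`.

-- Injective self-maps of finite sets

-- A missed value `y` could be punched out of the codomain, leaving an injection from `suc n`
-- elements into `n`.
injective⇒strictlySurjective : ∀ {n} {f : Fin n → Fin n} → Injective _≡_ _≡_ f → StrictlySurjective _≡_ f
injective⇒strictlySurjective {suc n} {f} f-injective y with anyᶠ? (λ x → f x ≟ᶠ y)
... | yes fx≡y = fx≡y
... | no  y∉f = contradiction (injective⇒≤ punched-injective) ℕ.1+n≰n
  where
  y≢f : ∀ x → y ≢ f x
  y≢f x y≡fx = y∉f (x , ≡.sym y≡fx)
  punched : Fin (suc n) → Fin n
  punched x = punchOut (y≢f x)
  punched-injective : Injective _≡_ _≡_ punched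
  punched-injective {x} {x′} eq = f-injective (punchOut-injective (y≢f x) (y≢f x′) eq)

module FiniteSetoid {a r} (S : Setoid a r) {n} (enum : Inverse S (≡.setoid (Fin n))) where
  open Setoid S

  index : Carrier → Fin n
  index = Inverse.to enum

  element : Fin n → Carrier
  element = Inverse.from enum

  element-index : ∀ x → element (index x) ≈ x
  element-index = Inverse.strictlyInverseʳ enum

  index-element : ∀ i → index (element i) ≡ i
  index-element = Inverse.strictlyInverseˡ enum

  index-injective : Injective _≈_ _≡_ index
  index-injective {x} {y} eq = trans (sym (element-index x)) (trans (Inverse.from-cong enum eq) (element-index y))

  _≟_ : Decidable _≈_
  x ≟ y = map′ index-injective (Inverse.to-cong enum) (index x ≟ᶠ index y)

  any? : ∀ {p} {P : Pred Carrier p} → P Respects _≈_ → U.Decidable P → Dec (∃ P)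
  any? {P = P} resp P? = map′ (λ (i , Pi) → element i , Pi) (λ (x , Px) → index x , resp (sym (element-index x)) Px)
                      (anyᶠ? (λ i → P? (element i)))

  module Endofunction {f : Carrier → Carrier} (f-cong : Congruent _≈_ _≈_ f) (f-injective : Injective _≈_ _≈_ f) where
    onIndex : Fin n → Fin n
    onIndex = index ∘ f ∘ element

    onIndex-injective : Injective _≡_ _≡_ onIndex
    onIndex-injective {i} {j} eq = ≡.trans (≡.sym (index-element i)) (≡.trans (Inverse.to-cong enum (f-injective (index-injective eq))) (index-element j))

    strictlySurjective : StrictlySurjective _≈_ f
    strictlySurjective y with i , eq ← injective⇒strictlySurjective onIndex-injective (index y) = element i , index-injective eq

    bijective : Bijective _≈_ _≈_ f
    bijective = f-injective , λ y → let x , fx≈y = strictlySurjective y in x , λ z≈x → trans (f-cong z≈x) fx≈y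

  -- Makes `Endofunction` applicable to the plane, where injectivity of the theorem's map then
  -- yields bijectivity.
  pairs : Inverse (×-setoid S S) (≡.setoid (Fin (n ℕ.* n)))
  pairs = record
    { to        = λ (x , y) → combine (index x) (index y)
    ; from      = from
    ; to-cong   = λ (p , q) → ≡.cong₂ combine (Inverse.to-cong enum p) (Inverse.to-cong enum q)
    ; from-cong = λ { ≡.refl → refl , refl }
    ; inverse   = (λ {i} {xy} eq → ≡.trans (≡.cong₂ combine
                       (≡.trans (Inverse.to-cong enum (proj₁ eq)) (index-element _))
                       (≡.trans (Inverse.to-cong enum (proj₂ eq)) (index-element _)))
                     (combine-remQuot {n} n i))
                , (λ { {x , y} ≡.refl →
                       trans (reflexive (≡.cong (element ∘ proj₁) (remQuot-combine (index x) (index y)))) (element-index x)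
                     , trans (reflexive (≡.cong (element ∘ proj₂) (remQuot-combine (index x) (index y)))) (element-index y) })
    }
    where
    from : Fin (n ℕ.* n) → Carrier × Carrier
    from i = element (proj₁ (remQuot {n} n i)) , element (proj₂ (remQuot {n} n i))

-- Sums over a finite setoid, in any commutative monoid so that products are covered too

module Summation {c ℓ a r} (M : CommutativeMonoid c ℓ) (S : Setoid a r) {n} (enum : Inverse S (≡.setoid (Fin n))) where
  open CommutativeMonoid M
  open import Algebra.Properties.CommutativeMonoid.Sum M as Fin∑ using (sum)
  open import Relation.Binary.Reasoning.Setoid setoid
  open Setoid S using () renaming (Carrier to A; _≈_ to _≋_; sym to ≋-sym)
  open FiniteSetoid S enum

  ∑ : (A → Carrier) → Carrier
  ∑ g = sum (g ∘ element)

  ∑-cong : ∀ {g h} → (∀ x → g x ≈ h x) → ∑ g ≈ ∑ h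
  ∑-cong g≈h = Fin∑.sum-cong-≋ (g≈h ∘ element)

  ∑-distrib : ∀ g h → ∑ (λ x → g x ∙ h x) ≈ ∑ g ∙ ∑ h
  ∑-distrib g h = Fin∑.∑-distrib-+ (g ∘ element) (h ∘ element)

  ∑-reindex : ∀ {f g} → Congruent _≋_ _≋_ f → Injective _≋_ _≋_ f → Congruent _≋_ _≈_ g → ∑ (g ∘ f) ≈ ∑ g
  ∑-reindex {f} {g} f-cong f-injective g-cong = begin
    sum (g ∘ f ∘ element)         ≈⟨ Fin∑.sum-cong-≋ (λ i → g-cong (≋-sym (element-index (f (element i))))) ⟩
    sum (g ∘ element ∘ onIndex)   ≈⟨ Fin∑.sum-permute (g ∘ element) π ⟨
    sum (g ∘ element)             ∎
    where
    open Endofunction f-cong f-injective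
    surj = injective⇒strictlySurjective onIndex-injective
    π = permutation onIndex (proj₁ ∘ surj) (proj₂ ∘ surj) (λ i → onIndex-injective (proj₂ (surj (onIndex i))))

  ∑-single : ∀ {g} → Congruent _≋_ _≈_ g → ∀ x₀ → (∀ x → ¬ x ≋ x₀ → g x ≈ ε) → ∑ g ≈ g x₀
  ∑-single {g} g-cong x₀ g≈ε = trans
    (single (g ∘ element) (index x₀) λ j j≢ → g≈ε (element j) λ eq →
       j≢ (≡.trans (≡.sym (index-element j)) (Inverse.to-cong enum eq)))
    (g-cong (element-index x₀))
    where
    single : ∀ {m} (t : Fin m → Carrier) i → (∀ j → j ≢ i → t j ≈ ε) → sum t ≈ t i
    single {suc m} t zero t≈ε = begin
      t zero ∙ sum (t ∘ suc)  ≈⟨ ∙-congˡ (Fin∑.sum-cong-≋ (λ j → t≈ε (suc j) λ ())) ⟩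
      t zero ∙ sum {m} (λ _ → ε)  ≈⟨ ∙-congˡ (Fin∑.sum-replicate-zero m) ⟩
      t zero ∙ ε              ≈⟨ identityʳ _ ⟩
      t zero                  ∎
    single {suc m} t (suc i) t≈ε = begin
      t zero ∙ sum (t ∘ suc)  ≈⟨ ∙-cong (t≈ε zero λ ()) (single (t ∘ suc) i (λ j j≢i → t≈ε (suc j) (j≢i ∘ suc-injective))) ⟩
      ε ∙ t (suc i)           ≈⟨ identityˡ _ ⟩
      t (suc i)               ∎

-- Finite fields

module FiniteField {c ℓ₁ ℓ₂} (F : HeytingField c ℓ₁ ℓ₂) {n} (order : Field.HasOrder F n) where
  open Field F using (commutativeRing)
  open CommutativeRing commutativeRing public hiding (_≉_; zero)
  open Field F public using (_^_; _≉_)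
  open HeytingField F using (_#_; #⇒invertible; invertible⇒#; tight; #-irrefl)
  open import Algebra.Properties.Ring ring using (-0#≈0#)
  open import Algebra.Properties.CommutativeSemiring.Exp commutativeSemiring public
    using (^-congˡ; ^-congʳ; ^-homo-*; ^-assocʳ; ^-distrib-*)
  open import Algebra.Properties.Semiring.Mult semiring public using (×-homo-+) renaming (_×_ to infixr 8 _·_)
  open import Algebra.Properties.CommutativeMonoid.Sum using (sum-replicate)
  open import Relation.Binary.Reasoning.Setoid setoid
  open FiniteSetoid setoid order public
  module ∑ = Summation +-commutativeMonoid setoid order
  module ∏ = Summation *-commutativeMonoid setoid order
  open ∑ public using (∑)
  open ∏ using () renaming (∑ to ∏)

  x-0≈x : ∀ x → x - 0# ≈ x
  x-0≈x x = trans (+-congˡ -0#≈0#) (+-identityʳ x)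

  1≉0 : 1# ≉ 0#
  1≉0 1≈0 = #-irrefl 1≈0 (invertible⇒# (1# , trans (*-identityˡ _) (x-0≈x 1#) , trans (*-identityʳ _) (x-0≈x 1#)))

  -- A finite search replaces apartness: if it finds no inverse, then `x` is not apart from 0, and
  -- tightness makes it equal to 0.
  inverseOf : ∀ {x} → x ≉ 0# → ∃ λ y → x * y ≈ 1#
  inverseOf {x} x≉0 with any? (λ y≈z → trans (*-congˡ (sym y≈z))) (λ y → (x * y) ≟ 1#)
  ... | yes inverse = inverse
  ... | no ¬inverse = contradiction (proj₁ (tight x 0#) x¬#0) x≉0
    where
    x¬#0 : ¬ x # 0#
    x¬#0 x#0 = let y , _ , eq = #⇒invertible x#0 in ¬inverse (y , trans (*-congʳ (sym (x-0≈x x))) eq)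

  opaque
    -- Total: 0 ⁻¹ = 0.
    infix 9 _⁻¹
    _⁻¹ : Carrier → Carrier
    x ⁻¹ with x ≟ 0#
    ... | yes _   = 0#
    ... | no  x≉0 = proj₁ (inverseOf x≉0)

    *-inverse : ∀ {x} → x ≉ 0# → x * x ⁻¹ ≈ 1#
    *-inverse {x} x≉0 with x ≟ 0#
    ... | yes x≈0 = contradiction x≈0 x≉0
    ... | no  x≉0 = proj₂ (inverseOf x≉0)

    ⁻¹-zero : ∀ {x} → x ≈ 0# → x ⁻¹ ≈ 0#
    ⁻¹-zero {x} x≈0 with x ≟ 0#
    ... | yes _   = refl
    ... | no  x≉0 = contradiction x≈0 x≉0

  *-cancelˡ : ∀ {x y z} → x ≉ 0# → x * y ≈ x * z → y ≈ z
  *-cancelˡ {x} {y} {z} x≉0 eq = trans (sym (undo y)) (trans (*-congˡ eq) (undo z))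
    where
    undo : ∀ w → x ⁻¹ * (x * w) ≈ w
    undo w = trans (sym (*-assoc _ _ _)) (trans (*-congʳ (trans (*-comm _ _) (*-inverse x≉0))) (*-identityˡ w))

  *-cancelʳ : ∀ {x y z} → x ≉ 0# → y * x ≈ z * x → y ≈ z
  *-cancelʳ x≉0 eq = *-cancelˡ x≉0 (trans (*-comm _ _) (trans eq (*-comm _ _)))

  x*y≈0⇒x≈0∨y≈0 : ∀ {x y} → x * y ≈ 0# → x ≈ 0# ⊎ y ≈ 0#
  x*y≈0⇒x≈0∨y≈0 {x} {y} eq with x ≟ 0#
  ... | yes x≈0 = inj₁ x≈0
  ... | no  x≉0 = inj₂ (*-cancelˡ x≉0 (trans eq (sym (zeroʳ x))))

  *-nonZero : ∀ {x y} → x ≉ 0# → y ≉ 0# → x * y ≉ 0#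
  *-nonZero x≉0 y≉0 eq with x*y≈0⇒x≈0∨y≈0 eq
  ... | inj₁ x≈0 = x≉0 x≈0
  ... | inj₂ y≈0 = y≉0 y≈0

  ^-nonZero : ∀ {x} m → x ≉ 0# → x ^ m ≉ 0#
  ^-nonZero zero    x≉0 = 1≉0
  ^-nonZero (suc m) x≉0 = *-nonZero x≉0 (^-nonZero m x≉0)

  ⁻¹-nonZero : ∀ {x} → x ≉ 0# → x ⁻¹ ≉ 0#
  ⁻¹-nonZero {x} x≉0 eq = 1≉0 (trans (sym (*-inverse x≉0)) (trans (*-congˡ eq) (zeroʳ x)))

  ⁻¹-unique : ∀ {x y} → x * y ≈ 1# → y ≈ x ⁻¹
  ⁻¹-unique {x} {y} xy≈1 = *-cancelˡ x≉0 (trans xy≈1 (sym (*-inverse x≉0)))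
    where
    x≉0 : x ≉ 0#
    x≉0 x≈0 = 1≉0 (trans (sym xy≈1) (trans (*-congʳ x≈0) (zeroˡ y)))

  ⁻¹-cong : Congruent _≈_ _≈_ _⁻¹
  ⁻¹-cong {x} {y} x≈y with y ≟ 0#
  ... | yes y≈0 = trans (⁻¹-zero (trans x≈y y≈0)) (sym (⁻¹-zero y≈0))
  ... | no  y≉0 = ⁻¹-unique (trans (*-congʳ (sym x≈y)) (*-inverse λ x≈0 → y≉0 (trans (sym x≈y) x≈0)))

  ⁻¹-involutive : ∀ x → x ⁻¹ ⁻¹ ≈ x
  ⁻¹-involutive x with x ≟ 0#
  ... | yes x≈0 = trans (⁻¹-zero (⁻¹-zero x≈0)) (sym x≈0)
  ... | no  x≉0 = sym (⁻¹-unique (trans (*-comm _ _) (*-inverse x≉0)))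

  ⁻¹-injective : Injective _≈_ _≈_ _⁻¹
  ⁻¹-injective {x} {y} eq = trans (sym (⁻¹-involutive x)) (trans (⁻¹-cong eq) (⁻¹-involutive y))

  -- Translation by 1 permutes the field, so adding n ones does not change ∑ x.
  n×1≈0 : n · 1# ≈ 0#
  n×1≈0 = begin
    n · 1#  ≈⟨ sum-replicate +-commutativeMonoid n ⟨
    ∑ (λ _ → 1#)  ≈⟨ +-cancelˡ (∑ (λ x → x)) _ _ (begin
       ∑ (λ x → x) + ∑ (λ _ → 1#)   ≈⟨ ∑.∑-distrib (λ x → x) (λ _ → 1#) ⟨
       ∑ (λ x → x + 1#)             ≈⟨ ∑.∑-reindex +-congʳ (+-cancelʳ 1# _ _) (λ eq → eq) ⟩
       ∑ (λ x → x)                  ≈⟨ +-identityʳ _ ⟨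
       ∑ (λ x → x) + 0#             ∎) ⟩
    0# ∎
    where open import Algebra.Properties.Group +-group using () renaming (∙-cancelˡ to +-cancelˡ; ∙-cancelʳ to +-cancelʳ)

  opaque
    -- Lets products over the nonzero elements run over the whole field with factor 1 at 0, and
    -- gives the indicator function of 0.
    if0_then_else_ : Carrier → Carrier → Carrier → Carrier
    if0 x then y else z with x ≟ 0#
    ... | yes _ = y
    ... | no  _ = z

    if0-yes : ∀ {x y z} → x ≈ 0# → if0 x then y else z ≈ y
    if0-yes {x} x≈0 with x ≟ 0#
    ... | yes _   = refl
    ... | no  x≉0 = contradiction x≈0 x≉0

    if0-no : ∀ {x y z} → x ≉ 0# → if0 x then y else z ≈ z
    if0-no {x} x≉0 with x ≟ 0#
    ... | yes x≈0 = contradiction x≈0 x≉0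
    ... | no  _   = refl

  if0-cong : ∀ {x x′ y y′ z z′} → x ≈ x′ → y ≈ y′ → z ≈ z′ → if0 x then y else z ≈ if0 x′ then y′ else z′
  if0-cong {x} {x′} x≈x′ y≈y′ z≈z′ with x ≟ 0#
  ... | yes x≈0 = trans (if0-yes x≈0) (trans y≈y′ (sym (if0-yes (trans (sym x≈x′) x≈0))))
  ... | no  x≉0 = trans (if0-no x≉0) (trans z≈z′ (sym (if0-no (λ x′≈0 → x≉0 (trans x≈x′ x′≈0)))))

  ∏-nonZero : ∀ g → (∀ x → g x ≉ 0#) → ∏ g ≉ 0#
  ∏-nonZero g g≉0 = product-nonZero (λ i → g (element i)) (λ i → g≉0 (element i))
    where
    open import Algebra.Definitions.RawMonoid (CommutativeMonoid.rawMonoid *-commutativeMonoid) using (sum)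
    product-nonZero : ∀ {m} (t : Fin m → Carrier) → (∀ i → t i ≉ 0#) → sum t ≉ 0#
    product-nonZero {zero}  t t≉0 = 1≉0
    product-nonZero {suc m} t t≉0 = *-nonZero (t≉0 Fin.zero) (product-nonZero (λ i → t (Fin.suc i)) (λ i → t≉0 (Fin.suc i)))

  -- Multiplication by x permutes the nonzero elements, so the product of n - 1 copies of x is 1.
  x^n≈x : ∀ x → x ^ n ≈ x
  x^n≈x x with x ≟ 0#
  ... | yes x≈0 = trans (^-congˡ n x≈0) (trans (0^n n n≢0) (sym x≈0))
    where
    n≢0 : n ≢ 0
    n≢0 ≡.refl with () ← index 0#
    0^n : ∀ m → m ≢ 0 → 0# ^ m ≈ 0#
    0^n zero    0≢0 = contradiction ≡.refl 0≢0
    0^n (suc m) _   = zeroˡ _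
  ... | no  x≉0 = begin
    x ^ n                ≈⟨ sum-replicate *-commutativeMonoid n ⟨
    ∏ (λ _ → x)          ≈⟨ ∏.∑-cong split ⟩
    ∏ (λ y → unit y x * (if0 y then x else 1#)) ≈⟨ ∏.∑-distrib (λ y → unit y x) (λ y → if0 y then x else 1#) ⟩
    ∏ (λ y → unit y x) * ∏ (λ y → if0 y then x else 1#)
      ≈⟨ *-cong ∏unit≈1 (∏.∑-single (λ eq → if0-cong eq refl refl) 0# (λ _ → if0-no)) ⟩
    1# * (if0 0# then x else 1#)  ≈⟨ *-identityˡ _ ⟩
    if0 0# then x else 1#  ≈⟨ if0-yes refl ⟩
    x                      ∎
    where
    unit : Carrier → Carrier → Carrier
    unit y z = if0 y then 1# else z

    -- There are `n` copies of `x` but only `n - 1` nonzero `y`; the copy at `y = 0` is split off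
    -- and survives as the final `x`.
    split : ∀ y → x ≈ unit y x * (if0 y then x else 1#)
    split y with y ≟ 0#
    ... | yes y≈0 = sym (trans (*-cong (if0-yes y≈0) (if0-yes y≈0)) (*-identityˡ x))
    ... | no  y≉0 = sym (trans (*-cong (if0-no y≉0) (if0-no y≉0)) (*-identityʳ x))

    unit-* : ∀ y → unit (x * y) (x * y) ≈ unit y x * unit y y
    unit-* y with y ≟ 0#
    ... | yes y≈0 = trans (if0-yes (trans (*-congˡ y≈0) (zeroʳ x))) (sym (trans (*-cong (if0-yes y≈0) (if0-yes y≈0)) (*-identityˡ 1#)))
    ... | no  y≉0 = trans (if0-no (*-nonZero x≉0 y≉0)) (sym (*-cong (if0-no y≉0) (if0-no y≉0)))

    unit-nonZero : ∀ y → unit y y ≉ 0#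
    unit-nonZero y with y ≟ 0#
    ... | yes y≈0 = λ eq → 1≉0 (trans (sym (if0-yes y≈0)) eq)
    ... | no  y≉0 = λ eq → y≉0 (trans (sym (if0-no y≉0)) eq)

    ∏unit≈1 : ∏ (λ y → unit y x) ≈ 1#
    ∏unit≈1 = *-cancelʳ (∏-nonZero _ unit-nonZero) (begin
      ∏ (λ y → unit y x) * ∏ (λ y → unit y y)  ≈⟨ ∏.∑-distrib (λ y → unit y x) (λ y → unit y y) ⟨
      ∏ (λ y → unit y x * unit y y)            ≈⟨ ∏.∑-cong unit-* ⟨
      ∏ (λ y → unit (x * y) (x * y))           ≈⟨ ∏.∑-reindex *-congˡ (*-cancelˡ x≉0) (λ eq → if0-cong eq refl eq) ⟩
      ∏ (λ y → unit y y)                       ≈⟨ *-identityˡ _ ⟨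
      1# * ∏ (λ y → unit y y)                  ∎)

-- Characteristic 2 and the powers of Frobenius

module BinaryField {c ℓ₁ ℓ₂} (F : HeytingField c ℓ₁ ℓ₂) (k : ℕ) (order : Field.HasOrder F (2 ℕ.^ k)) where
  open FiniteField F order public
  open import Algebra.Properties.Semiring.Sum semiring public
    using (sum; sum-cong-≋; sum-replicate; sum-replicate-zero; sum-init-last; ∑-distrib-+; ∑-comm; *-distribˡ-sum; *-distribʳ-sum)
  open import Relation.Binary.Reasoning.Setoid setoid

  2^m·1≈[1+1]^m : ∀ m → (2 ℕ.^ m) · 1# ≈ (1# + 1#) ^ m
  2^m·1≈[1+1]^m zero    = +-identityʳ 1#
  2^m·1≈[1+1]^m (suc m) = begin
    (2 ℕ.^ m ℕ.+ (2 ℕ.^ m ℕ.+ 0)) · 1#    ≡⟨ ≡.cong (λ j → (2 ℕ.^ m ℕ.+ j) · 1#) (ℕ.+-identityʳ (2 ℕ.^ m)) ⟩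
    (2 ℕ.^ m ℕ.+ 2 ℕ.^ m) · 1#            ≈⟨ ×-homo-+ 1# (2 ℕ.^ m) (2 ℕ.^ m) ⟩
    (2 ℕ.^ m) · 1# + (2 ℕ.^ m) · 1#       ≈⟨ +-cong (2^m·1≈[1+1]^m m) (2^m·1≈[1+1]^m m) ⟩
    (1# + 1#) ^ m + (1# + 1#) ^ m         ≈⟨ +-cong (*-identityˡ _) (*-identityˡ _) ⟨
    1# * (1# + 1#) ^ m + 1# * (1# + 1#) ^ m  ≈⟨ distribʳ _ _ _ ⟨
    (1# + 1#) ^ suc m                     ∎

  -- The sum of `2 ^ k` ones is 0 and equals `(1# + 1#) ^ k`, and a field has no nonzero nilpotents.
  1+1≈0 : 1# + 1# ≈ 0#
  1+1≈0 with (1# + 1#) ≟ 0#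
  ... | yes eq  = eq
  ... | no  neq = contradiction (trans (sym (2^m·1≈[1+1]^m k)) n×1≈0) (^-nonZero k neq)

  x+x≈0 : ∀ x → x + x ≈ 0#
  x+x≈0 x = begin
    x + x            ≈⟨ +-cong (*-identityʳ x) (*-identityʳ x) ⟨
    x * 1# + x * 1#  ≈⟨ distribˡ x 1# 1# ⟨
    x * (1# + 1#)    ≈⟨ *-congˡ 1+1≈0 ⟩
    x * 0#           ≈⟨ zeroʳ x ⟩
    0#               ∎

  -- Polynomial identities are decided with coefficients in 𝔽₂, so that x + x normalises to 0.
  private
    𝔽₂ : RawRing _ _
    𝔽₂ = record { _≈_ = _≡_ ; _+_ = _xor_ ; _*_ = _∧_ ; -_ = id ; 0# = false ; 1# = true }

    ⟦_⟧₂ : Bool → Carrier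
    ⟦ true ⟧₂  = 1#
    ⟦ false ⟧₂ = 0#

    +-homo₂ : ∀ a b → ⟦ a xor b ⟧₂ ≈ ⟦ a ⟧₂ + ⟦ b ⟧₂
    +-homo₂ true  true  = sym 1+1≈0
    +-homo₂ true  false = sym (+-identityʳ 1#)
    +-homo₂ false b     = sym (+-identityˡ ⟦ b ⟧₂)

    *-homo₂ : ∀ a b → ⟦ a ∧ b ⟧₂ ≈ ⟦ a ⟧₂ * ⟦ b ⟧₂
    *-homo₂ true  b = sym (*-identityˡ ⟦ b ⟧₂)
    *-homo₂ false b = sym (zeroˡ ⟦ b ⟧₂)

    morphism : 𝔽₂ -Raw-AlmostCommutative⟶ fromCommutativeSemiring commutativeSemiring
    morphism = record
      { ⟦_⟧ = ⟦_⟧₂ ; +-homo = +-homo₂ ; *-homo = *-homo₂ ; -‿homo = λ _ → refl ; 0-homo = refl ; 1-homo = refl }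

  open import Algebra.Solver.Ring 𝔽₂ (fromCommutativeSemiring commutativeSemiring) morphism
    (λ a b → map (λ a≡b → reflexive (≡.cong ⟦_⟧₂ a≡b)) (dec⇒maybe (a Bool.≟ b))) public
    using (solve; _:+_; _:*_; _:=_; con)

  x≈x+y+y : ∀ x y → x ≈ x + y + y
  x≈x+y+y = solve 2 (λ x y → x := (x :+ y) :+ y) refl

  x+y≈0⇒x≈y : ∀ {x y} → x + y ≈ 0# → x ≈ y
  x+y≈0⇒x≈y {x} {y} eq = trans (x≈x+y+y x y) (trans (+-congʳ eq) (+-identityˡ y))

  x≈y⇒x+y≈0 : ∀ {x y} → x ≈ y → x + y ≈ 0#
  x≈y⇒x+y≈0 {x} {y} eq = trans (+-congʳ eq) (x+x≈0 y)

  opaque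
    -- The `m`-th iterate of Frobenius. Indexing by `m` turns composition into addition, as the
    -- Bézout argument and the cyclic shift of the trace require.
    φ : ℕ → Carrier → Carrier
    φ m x = x ^ (2 ℕ.^ m)

    φ≈^ : ∀ m x → φ m x ≈ x ^ (2 ℕ.^ m)
    φ≈^ m x = refl

    φ-cong : ∀ m → Congruent _≈_ _≈_ (φ m)
    φ-cong m = ^-congˡ (2 ℕ.^ m)

    φ-* : ∀ m x y → φ m (x * y) ≈ φ m x * φ m y
    φ-* m x y = ^-distrib-* x y (2 ℕ.^ m)

    φ-zero : ∀ x → φ 0 x ≈ x
    φ-zero = *-identityʳ

    φ-suc : ∀ m x → φ (suc m) x ≈ φ m x * φ m x
    φ-suc m x = trans (^-homo-* x (2 ℕ.^ m) _) (*-congˡ (^-congʳ x (ℕ.+-identityʳ (2 ℕ.^ m))))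

    φ-nonZero : ∀ m {x} → x ≉ 0# → φ m x ≉ 0#
    φ-nonZero m = ^-nonZero (2 ℕ.^ m)

    φ-∘ : ∀ m j x → φ m (φ j x) ≈ φ (j ℕ.+ m) x
    φ-∘ m j x = trans (^-assocʳ x (2 ℕ.^ j) (2 ℕ.^ m)) (^-congʳ x (≡.sym (ℕ.^-distribˡ-+-* 2 j m)))

    φ-order : ∀ x → φ k x ≈ x
    φ-order = x^n≈x

  φ-+ : ∀ m x y → φ m (x + y) ≈ φ m x + φ m y
  φ-+ zero    x y = trans (φ-zero _) (sym (+-cong (φ-zero x) (φ-zero y)))
  φ-+ (suc m) x y = begin
    φ (suc m) (x + y)                          ≈⟨ φ-suc m (x + y) ⟩
    φ m (x + y) * φ m (x + y)                  ≈⟨ *-cong (φ-+ m x y) (φ-+ m x y) ⟩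
    (φ m x + φ m y) * (φ m x + φ m y)          ≈⟨ solve 2 (λ a b → (a :+ b) :* (a :+ b) := a :* a :+ b :* b) refl (φ m x) (φ m y) ⟩
    φ m x * φ m x + φ m y * φ m y              ≈⟨ +-cong (φ-suc m x) (φ-suc m y) ⟨
    φ (suc m) x + φ (suc m) y                  ∎

  φ-0 : ∀ m → φ m 0# ≈ 0#
  φ-0 m = begin
    φ m 0#           ≈⟨ φ-cong m (+-identityˡ 0#) ⟨
    φ m (0# + 0#)    ≈⟨ φ-+ m 0# 0# ⟩
    φ m 0# + φ m 0#  ≈⟨ x+x≈0 _ ⟩
    0#               ∎

  φ-injective : ∀ m → Injective _≈_ _≈_ (φ m)
  φ-injective m {x} {y} eq with (x + y) ≟ 0#
  ... | yes x+y≈0 = x+y≈0⇒x≈y x+y≈0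
  ... | no  x+y≉0 = contradiction (trans (φ-+ m x y) (x≈y⇒x+y≈0 eq)) (φ-nonZero m x+y≉0)

  φ-1 : ∀ m → φ m 1# ≈ 1#
  φ-1 m = *-cancelˡ (φ-nonZero m 1≉0) (begin
    φ m 1# * φ m 1#  ≈⟨ φ-* m 1# 1# ⟨
    φ m (1# * 1#)    ≈⟨ φ-cong m (*-identityˡ 1#) ⟩
    φ m 1#           ≈⟨ *-identityʳ _ ⟨
    φ m 1# * 1#      ∎)

  φ-⁻¹ : ∀ m x → φ m (x ⁻¹) ≈ (φ m x) ⁻¹
  φ-⁻¹ m x with x ≟ 0#
  ... | yes x≈0 = trans (trans (φ-cong m (⁻¹-zero x≈0)) (φ-0 m)) (sym (⁻¹-zero (trans (φ-cong m x≈0) (φ-0 m))))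
  ... | no  x≉0 = ⁻¹-unique (trans (sym (φ-* m _ _)) (trans (φ-cong m (*-inverse x≉0)) (φ-1 m)))

  φ-comm : ∀ m j x → φ m (φ j x) ≈ φ j (φ m x)
  φ-comm m j x = trans (φ-∘ m j x) (trans (reflexive (≡.cong (λ i → φ i x) (ℕ.+-comm j m))) (sym (φ-∘ j m x)))

  φ-sum : ∀ m {j} (t : Fin j → Carrier) → φ m (sum t) ≈ sum (λ i → φ m (t i))
  φ-sum m {zero}  t = φ-0 m
  φ-sum m {suc j} t = trans (φ-+ m _ _) (+-congˡ (φ-sum m (λ i → t (suc i))))

  φ-fixes⇒φ-*-fixes : ∀ m {x} → φ m x ≈ x → ∀ j → φ (j ℕ.* m) x ≈ x
  φ-fixes⇒φ-*-fixes m fixed zero    = φ-zero _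
  φ-fixes⇒φ-*-fixes m {x} fixed (suc j) = begin
    φ (m ℕ.+ j ℕ.* m) x    ≈⟨ φ-∘ (j ℕ.* m) m x ⟨
    φ (j ℕ.* m) (φ m x)    ≈⟨ φ-cong (j ℕ.* m) fixed ⟩
    φ (j ℕ.* m) x          ≈⟨ φ-fixes⇒φ-*-fixes m fixed j ⟩
    x                      ∎

  x*x≈x⇒x≈0∨x≈1 : ∀ {x} → x * x ≈ x → x ≈ 0# ⊎ x ≈ 1#
  x*x≈x⇒x≈0∨x≈1 {x} eq with x ≟ 0#
  ... | yes x≈0 = inj₁ x≈0
  ... | no  x≉0 = inj₂ (*-cancelˡ x≉0 (trans eq (sym (*-identityʳ x))))

  -- By Bézout some multiples of `m` and of `k` differ by 1. Both corresponding iterates fix `x`,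
  -- hence so does Frobenius itself, that is, `x * x = x`.
  φ-fixes⇒0∨1 : ∀ m → Coprime m k → ∀ {x} → φ m x ≈ x → x ≈ 0# ⊎ x ≈ 1#
  φ-fixes⇒0∨1 m coprime {x} fixed = x*x≈x⇒x≈0∨x≈1 (trans (sym φ1x≈x*x) (φ1-fixes (ℕ.coprime-Bézout coprime)))
    where
    φ1x≈x*x : φ 1 x ≈ x * x
    φ1x≈x*x = trans (φ-suc 0 x) (*-cong (φ-zero x) (φ-zero x))
    φ1-via : ∀ i j → φ i x ≈ x → φ j x ≈ x → 1 ℕ.+ i ≡ j → φ 1 x ≈ x
    φ1-via i j fixedᵢ fixedⱼ ≡.refl = begin
      φ 1 x            ≈⟨ φ-cong 1 fixedᵢ ⟨
      φ 1 (φ i x)      ≈⟨ φ-comm 1 i x ⟩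
      φ i (φ 1 x)      ≈⟨ φ-∘ i 1 x ⟩
      φ (1 ℕ.+ i) x    ≈⟨ fixedⱼ ⟩
      x                ∎
    φ1-fixes : Bézout.Identity 1 m k → φ 1 x ≈ x
    φ1-fixes (Bézout.+- i j eq) = φ1-via (j ℕ.* k) (i ℕ.* m) (φ-fixes⇒φ-*-fixes k (φ-order x) j) (φ-fixes⇒φ-*-fixes m fixed i) eq
    φ1-fixes (Bézout.-+ i j eq) = φ1-via (i ℕ.* m) (j ℕ.* k) (φ-fixes⇒φ-*-fixes m fixed i) (φ-fixes⇒φ-*-fixes k (φ-order x) j) eq

-- Parity and coprimality of the exponents

-- In the shape `suc (h + h)` a sum over `k` indices splits by computation into a first term and `h`
-- pairs.
2∤⇒odd : ∀ n → 2 ∤ n → ∃ λ h → n ≡ suc (h ℕ.+ h)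
2∤⇒odd zero          2∤n = contradiction (divides-refl 0) 2∤n
2∤⇒odd 1             2∤n = 0 , ≡.refl
2∤⇒odd (suc (suc n)) 2∤n with 2∤⇒odd n (λ { (divides-refl j) → 2∤n (divides-refl (suc j)) })
... | h , ≡.refl = suc h , ≡.cong (λ j → suc (suc j)) (≡.sym (ℕ.+-suc h h))

2∤1+h+h : ∀ h → 2 ∤ suc (h ℕ.+ h)
2∤1+h+h h (divides q eq) = contradiction (≡.trans eq (≡.trans (ℕ.*-comm q 2) (≡.cong (q ℕ.+_) (ℕ.+-identityʳ q)))) (odd≢even h q)
  where
  odd≢even : ∀ h q → suc (h ℕ.+ h) ≢ q ℕ.+ q
  odd≢even zero    (suc q) eq with () ← ≡.trans (ℕ.suc-injective eq) (ℕ.+-suc q q)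
  odd≢even (suc h) (suc q) eq = odd≢even h q (ℕ.suc-injective (≡.trans (≡.sym (≡.cong suc (ℕ.+-suc h h))) (≡.trans (ℕ.suc-injective eq) (ℕ.+-suc q q))))

-- Serves to find the fixed field of `σ ∘ σ`, whose Frobenius exponent is `ℓ + ℓ`.
coprime-double : ∀ {k ℓ} → 2 ∤ k → Coprime k ℓ → Coprime (ℓ ℕ.+ ℓ) k
coprime-double {k} {ℓ} 2∤k coprime {d} (d∣2ℓ , d∣k) = coprime (d∣k , ℕ.coprime-divisor d⊥2 (≡.subst (d ∣_) (≡.cong (ℓ ℕ.+_) (≡.sym (ℕ.+-identityʳ ℓ))) d∣2ℓ))
  where
  d⊥2 : Coprime d 2
  d⊥2 (i∣d , i∣2) with prime⇒irreducible (from-yes (prime? 2)) i∣2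
  ... | inj₁ i≡1    = i≡1
  ... | inj₂ ≡.refl = contradiction (∣-trans i∣d d∣k) 2∤k

-- The automorphism `σ`, its norm-like map and the trace

module Trace {c ℓ₁ ℓ₂} (F : HeytingField c ℓ₁ ℓ₂) (h ℓ : ℕ) (order : Field.HasOrder F (2 ℕ.^ suc (h ℕ.+ h)))
             (coprime : Coprime (suc (h ℕ.+ h)) ℓ) where
  k : ℕ
  k = suc (h ℕ.+ h)
  open BinaryField F k order public
  open import Relation.Binary.Reasoning.Setoid setoid

  σ : Carrier → Carrier
  σ = φ ℓ

  σ-cong : Congruent _≈_ _≈_ σ
  σ-cong = φ-cong ℓ

  σ-+ : ∀ x y → σ (x + y) ≈ σ x + σ y
  σ-+ = φ-+ ℓ

  σ-* : ∀ x y → σ (x * y) ≈ σ x * σ y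
  σ-* = φ-* ℓ

  σ-1 : σ 1# ≈ 1#
  σ-1 = φ-1 ℓ

  σ-fixes⇒0∨1 : ∀ {x} → σ x ≈ x → x ≈ 0# ⊎ x ≈ 1#
  σ-fixes⇒0∨1 = φ-fixes⇒0∨1 ℓ (ℕ.sym coprime)

  0∨1⇒σ-fixes : ∀ {x} → x ≈ 0# ⊎ x ≈ 1# → σ x ≈ x
  0∨1⇒σ-fixes (inj₁ x≈0) = trans (σ-cong x≈0) (trans (φ-0 ℓ) (sym x≈0))
  0∨1⇒σ-fixes (inj₂ x≈1) = trans (σ-cong x≈1) (trans σ-1 (sym x≈1))

  -- σ x * x = 1 forces σ (σ x) = x, and the fixed field of σ² is still 𝔽₂ because k is odd.
  σx*x≈1⇒x≈1 : ∀ {x} → σ x * x ≈ 1# → x ≈ 1#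
  σx*x≈1⇒x≈1 {x} eq with φ-fixes⇒0∨1 (ℓ ℕ.+ ℓ) (coprime-double (2∤1+h+h h) coprime) σ²x≈x
    where
    σx≉0 : σ x ≉ 0#
    σx≉0 σx≈0 = 1≉0 (trans (sym eq) (trans (*-congʳ σx≈0) (zeroˡ x)))
    σ²x≈x : φ (ℓ ℕ.+ ℓ) x ≈ x
    σ²x≈x = trans (sym (φ-∘ ℓ ℓ x)) (*-cancelʳ σx≉0 (begin
      σ (σ x) * σ x  ≈⟨ σ-* (σ x) x ⟨
      σ (σ x * x)    ≈⟨ σ-cong eq ⟩
      σ 1#           ≈⟨ σ-1 ⟩
      1#             ≈⟨ eq ⟨
      σ x * x        ≈⟨ *-comm _ _ ⟩
      x * σ x        ∎))
  ... | inj₁ x≈0 = contradiction (trans (sym eq) (trans (*-congˡ x≈0) (zeroʳ _))) 1≉0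
  ... | inj₂ x≈1 = x≈1

  norm : Carrier → Carrier
  norm x = σ x * x

  norm-cong : Congruent _≈_ _≈_ norm
  norm-cong x≈y = *-cong (σ-cong x≈y) x≈y

  norm-* : ∀ x y → norm (x * y) ≈ norm x * norm y
  norm-* x y = trans (*-congʳ (σ-* x y)) (solve 4 (λ a b x y → (a :* b) :* (x :* y) := (a :* x) :* (b :* y)) refl (σ x) (σ y) x y)

  norm≈0⇒≈0 : ∀ {x} → norm x ≈ 0# → x ≈ 0#
  norm≈0⇒≈0 {x} eq with x ≟ 0#
  ... | yes x≈0 = x≈0
  ... | no  x≉0 = contradiction eq (*-nonZero (φ-nonZero ℓ x≉0) x≉0)

  norm-0 : norm 0# ≈ 0#
  norm-0 = zeroʳ _

  -- `norm` is multiplicative, so for nonzero `y` the quotient `x / y` has norm 1 and must be 1.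
  norm-injective : Injective _≈_ _≈_ norm
  norm-injective {x} {y} eq with y ≟ 0#
  ... | yes y≈0 = trans (norm≈0⇒≈0 (trans eq (trans (norm-cong y≈0) norm-0))) (sym y≈0)
  ... | no  y≉0 = begin
    x               ≈⟨ *-identityʳ x ⟨
    x * 1#          ≈⟨ *-congˡ (*-inverse y≉0) ⟨
    x * (y * y ⁻¹)  ≈⟨ solve 3 (λ x y z → x :* (y :* z) := (x :* z) :* y) refl x y (y ⁻¹) ⟩
    (x * y ⁻¹) * y  ≈⟨ *-congʳ (σx*x≈1⇒x≈1 norm≈1) ⟩
    1# * y          ≈⟨ *-identityˡ y ⟩
    y               ∎
    where
    norm≈1 : norm (x * y ⁻¹) ≈ 1#
    norm≈1 = begin
      norm (x * y ⁻¹)       ≈⟨ norm-* x (y ⁻¹) ⟩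
      norm x * norm (y ⁻¹)  ≈⟨ *-congʳ eq ⟩
      norm y * norm (y ⁻¹)  ≈⟨ norm-* y (y ⁻¹) ⟨
      norm (y * y ⁻¹)       ≈⟨ norm-cong (*-inverse y≉0) ⟩
      norm 1#               ≈⟨ trans (*-identityʳ _) σ-1 ⟩
      1#                    ∎

  norm-surjective : ∀ y → ∃ λ x → norm x ≈ y
  norm-surjective = Endofunction.strictlySurjective norm-cong norm-injective

  φ-kℓ : ∀ x → φ (k ℕ.* ℓ) x ≈ x
  φ-kℓ x = trans (reflexive (≡.cong (λ i → φ i x) (ℕ.*-comm k ℓ))) (φ-fixes⇒φ-*-fixes k (φ-order x) ℓ)

  opaque
    -- The absolute trace: as `ℓ` is coprime to `k`, the powers of `σ` run through all powers of
    -- Frobenius. Summing over powers of `σ` makes invariance under `σ` a shift of indices.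
    τ : Carrier → Carrier
    τ x = sum {k} (λ j → φ (toℕ j ℕ.* ℓ) x)

    τ≈sum : ∀ x → τ x ≈ sum {k} (λ j → φ (toℕ j ℕ.* ℓ) x)
    τ≈sum x = refl

    τ-cong : Congruent _≈_ _≈_ τ
    τ-cong x≈y = sum-cong-≋ {k} (λ j → φ-cong (toℕ j ℕ.* ℓ) x≈y)

    τ-+ : ∀ x y → τ (x + y) ≈ τ x + τ y
    τ-+ x y = trans (sum-cong-≋ {k} (λ j → φ-+ (toℕ j ℕ.* ℓ) x y)) (∑-distrib-+ {k} (λ j → φ (toℕ j ℕ.* ℓ) x) (λ j → φ (toℕ j ℕ.* ℓ) y))

    σ-τ : ∀ x → σ (τ x) ≈ τ (σ x)
    σ-τ x = trans (φ-sum ℓ {k} (λ j → φ (toℕ j ℕ.* ℓ) x)) (sum-cong-≋ {k} (λ j → φ-comm ℓ (toℕ j ℕ.* ℓ) x))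

    -- `σ` shifts the `k` terms cyclically: the last one becomes `σ` applied `k` times, which is `x`
    -- again.
    τ-σ : ∀ x → τ (σ x) ≈ τ x
    τ-σ x = begin
      sum {k} (λ j → φ (toℕ j ℕ.* ℓ) (σ x))      ≈⟨ sum-cong-≋ {k} (λ j → φ-∘ (toℕ j ℕ.* ℓ) ℓ x) ⟩
      sum {k} (λ j → φ (suc (toℕ j) ℕ.* ℓ) x)    ≈⟨ sum-init-last {h ℕ.+ h} (λ j → φ (suc (toℕ j) ℕ.* ℓ) x) ⟩
      sum {h ℕ.+ h} (λ j → φ (suc (toℕ (inject₁ j)) ℕ.* ℓ) x) + φ (suc (toℕ (fromℕ (h ℕ.+ h))) ℕ.* ℓ) x
        ≈⟨ +-cong (sum-cong-≋ {h ℕ.+ h} (λ j → reflexive (≡.cong (λ i → φ (suc i ℕ.* ℓ) x) (toℕ-inject₁ j))))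
                  (reflexive (≡.cong (λ i → φ (suc i ℕ.* ℓ) x) (toℕ-fromℕ (h ℕ.+ h)))) ⟩
      sum {h ℕ.+ h} (λ j → φ (suc (toℕ j) ℕ.* ℓ) x) + φ (k ℕ.* ℓ) x
        ≈⟨ +-comm _ _ ⟩
      φ (k ℕ.* ℓ) x + sum {h ℕ.+ h} (λ j → φ (suc (toℕ j) ℕ.* ℓ) x)
        ≈⟨ +-congʳ (trans (φ-kℓ x) (sym (φ-zero x))) ⟩
      φ 0 x + sum {h ℕ.+ h} (λ j → φ (suc (toℕ j) ℕ.* ℓ) x)  ∎

    τ-0 : τ 0# ≈ 0#
    τ-0 = trans (sum-cong-≋ {k} (λ j → φ-0 (toℕ j ℕ.* ℓ))) (sum-replicate-zero k)

    -- The oddness of `k` enters here: `h + h` of the ones cancel and a single one remains.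
    τ-1 : τ 1# ≈ 1#
    τ-1 = begin
      τ 1#                           ≈⟨ sum-cong-≋ {k} (λ j → φ-1 (toℕ j ℕ.* ℓ)) ⟩
      sum {k} (λ _ → 1#)             ≈⟨ sum-replicate k ⟩
      1# + (h ℕ.+ h) · 1#            ≈⟨ +-congˡ (trans (×-homo-+ 1# h h) (x+x≈0 _)) ⟩
      1# + 0#                        ≈⟨ +-identityʳ 1# ⟩
      1#                             ∎

  τ≈0∨1 : ∀ x → τ x ≈ 0# ⊎ τ x ≈ 1#
  τ≈0∨1 x = σ-fixes⇒0∨1 (trans (σ-τ x) (τ-σ x))

  τ-τ : ∀ x → τ (τ x) ≈ τ x
  τ-τ x with τ≈0∨1 x
  ... | inj₁ τx≈0 = trans (τ-cong τx≈0) (trans τ-0 (sym τx≈0))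
  ... | inj₂ τx≈1 = trans (τ-cong τx≈1) (trans τ-1 (sym τx≈1))

  τ-[x+1] : ∀ x → τ (x + 1#) ≈ τ x + 1#
  τ-[x+1] x = trans (τ-+ x 1#) (+-congˡ τ-1)

  τ[σx+x]≈0 : ∀ x → τ (σ x + x) ≈ 0#
  τ[σx+x]≈0 x = trans (τ-+ (σ x) x) (x≈y⇒x+y≈0 (τ-σ x))

  -- The left side has trace 0, whereas 1 has trace 1.
  σx+x≉1 : ∀ x → σ x + x ≉ 1#
  σx+x≉1 x eq = 1≉0 (trans (sym τ-1) (trans (τ-cong (sym eq)) (τ[σx+x]≈0 x)))

  σx+x≈0⇒x≈0∨1 : ∀ {x} → σ x + x ≈ 0# → x ≈ 0# ⊎ x ≈ 1#
  σx+x≈0⇒x≈0∨1 eq = σ-fixes⇒0∨1 (x+y≈0⇒x≈y eq)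

  -- The map `σ x + x` has kernel `{0, 1}` and only reaches trace 0. Adding `τ x` repairs both
  -- defects, giving a bijection that preserves the trace.
  θ : Carrier → Carrier
  θ x = σ x + x + τ x

  θ-cong : Congruent _≈_ _≈_ θ
  θ-cong x≈y = +-cong (+-cong (σ-cong x≈y) x≈y) (τ-cong x≈y)

  τ-θ : ∀ x → τ (θ x) ≈ τ x
  τ-θ x = begin
    τ (σ x + x + τ x)        ≈⟨ τ-+ (σ x + x) (τ x) ⟩
    τ (σ x + x) + τ (τ x)    ≈⟨ +-cong (τ[σx+x]≈0 x) (τ-τ x) ⟩
    0# + τ x                 ≈⟨ +-identityˡ _ ⟩
    τ x                      ∎

  θ≈0⇒≈0 : ∀ {x} → θ x ≈ 0# → x ≈ 0#
  θ≈0⇒≈0 {x} eq with σx+x≈0⇒x≈0∨1 σx+x≈0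
    where
    τx≈0 : τ x ≈ 0#
    τx≈0 = trans (sym (τ-θ x)) (trans (τ-cong eq) τ-0)
    σx+x≈0 : σ x + x ≈ 0#
    σx+x≈0 = trans (sym (+-identityʳ _)) (trans (+-congˡ (sym τx≈0)) eq)
  ... | inj₁ x≈0 = x≈0
  ... | inj₂ x≈1 = contradiction (trans (sym τ-1) (trans (τ-cong (sym x≈1)) (trans (sym (τ-θ x)) (trans (τ-cong eq) τ-0)))) 1≉0

  θ-injective : Injective _≈_ _≈_ θ
  θ-injective {x} {y} eq = x+y≈0⇒x≈y (θ≈0⇒≈0 (begin
    σ (x + y) + (x + y) + τ (x + y)        ≈⟨ +-cong (+-congʳ (σ-+ x y)) (τ-+ x y) ⟩
    σ x + σ y + (x + y) + (τ x + τ y)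
      ≈⟨ solve 6 (λ a b x y t u → ((a :+ b) :+ (x :+ y)) :+ (t :+ u) := ((a :+ x) :+ t) :+ ((b :+ y) :+ u)) refl (σ x) (σ y) x y (τ x) (τ y) ⟩
    θ x + θ y                              ≈⟨ x≈y⇒x+y≈0 eq ⟩
    0#                                     ∎))

  -- A preimage `b` of `w` under `θ` satisfies `σ b + b = w + τ b`, and `τ b` is 0 or 1.
  σb+b≈w∨w+1 : ∀ w → ∃ λ b → σ b + b ≈ w ⊎ σ b + b ≈ w + 1#
  σb+b≈w∨w+1 w = b , split (τ≈0∨1 b)
    where
    preimage : ∃ λ b → θ b ≈ w
    preimage = Endofunction.strictlySurjective θ-cong θ-injective w
    b : Carrier
    b = proj₁ preimage
    eq : θ b ≈ w
    eq = proj₂ preimage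
    split : τ b ≈ 0# ⊎ τ b ≈ 1# → σ b + b ≈ w ⊎ σ b + b ≈ w + 1#
    split (inj₁ τb≈0) = inj₁ (trans (sym (+-identityʳ _)) (trans (+-congˡ (sym τb≈0)) eq))
    split (inj₂ τb≈1) = inj₂ (begin
      σ b + b              ≈⟨ x≈x+y+y (σ b + b) 1# ⟩
      σ b + b + 1# + 1#    ≈⟨ +-congʳ (trans (+-congˡ (sym τb≈1)) eq) ⟩
      w + 1#               ∎)

  -- The sum of the inverses of the elements of trace 1

  -- The first and last terms agree and cancel in characteristic 2; induction handles the terms
  -- between them.
  sum-palindrome : ∀ m (f : ℕ → Carrier) → (∀ i j → suc (i ℕ.+ j) ≡ m ℕ.+ m → f i ≈ f j) → sum {m ℕ.+ m} (f ∘ toℕ) ≈ 0#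
  sum-palindrome zero    f f-sym = refl
  sum-palindrome (suc m) f f-sym rewrite ℕ.+-suc m m = begin
    f 0 + sum {suc (m ℕ.+ m)} (f ∘ suc ∘ toℕ)
      ≈⟨ +-congˡ (sum-init-last (f ∘ suc ∘ toℕ)) ⟩
    f 0 + (sum {m ℕ.+ m} (f ∘ suc ∘ toℕ ∘ inject₁) + f (suc (toℕ (fromℕ (m ℕ.+ m)))))
      ≈⟨ +-congˡ (+-cong (sum-cong-≋ {m ℕ.+ m} (λ j → reflexive (≡.cong (f ∘ suc) (toℕ-inject₁ j))))
                         (trans (reflexive (≡.cong (f ∘ suc) (toℕ-fromℕ (m ℕ.+ m)))) (sym (f-sym 0 _ ≡.refl)))) ⟩
    f 0 + (sum {m ℕ.+ m} (f ∘ suc ∘ toℕ) + f 0)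
      ≈⟨ +-congˡ (+-congʳ (sum-palindrome m (f ∘ suc) λ i j eq → f-sym (suc i) (suc j) (≡.cong suc (≡.trans (ℕ.+-suc (suc i) j) (≡.cong suc eq))))) ⟩
    f 0 + (0# + f 0)  ≈⟨ +-congˡ (+-identityˡ (f 0)) ⟩
    f 0 + f 0         ≈⟨ x+x≈0 _ ⟩
    0#                ∎

  ∑1≈0 : ∑ (λ _ → 1#) ≈ 0#
  ∑1≈0 = trans (sum-replicate (2 ℕ.^ k)) n×1≈0

  -- Since `0 ⁻¹` is 0, the term at 0 vanishes, and what remains is an odd number of ones.
  ∑xx⁻¹≈1 : ∑ (λ x → x * x ⁻¹) ≈ 1#
  ∑xx⁻¹≈1 = x+y≈0⇒x≈y (begin
    ∑ (λ x → x * x ⁻¹) + 1#            ≈⟨ +-congˡ (sym (trans (∑.∑-single (λ eq → if0-cong eq refl refl) 0# (λ _ → if0-no)) (if0-yes refl))) ⟩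
    ∑ (λ x → x * x ⁻¹) + ∑ (λ x → if0 x then 1# else 0#)
      ≈⟨ ∑.∑-distrib (λ x → x * x ⁻¹) (λ x → if0 x then 1# else 0#) ⟨
    ∑ (λ x → x * x ⁻¹ + (if0 x then 1# else 0#))  ≈⟨ ∑.∑-cong total ⟩
    ∑ (λ _ → 1#)                       ≈⟨ ∑1≈0 ⟩
    0#                                 ∎)
    where
    total : ∀ x → x * x ⁻¹ + (if0 x then 1# else 0#) ≈ 1#
    total x = by-cases (x ≟ 0#)
      where
      by-cases : Dec (x ≈ 0#) → x * x ⁻¹ + (if0 x then 1# else 0#) ≈ 1#
      by-cases (yes x≈0) = trans (+-cong (trans (*-congʳ x≈0) (zeroˡ _)) (if0-yes x≈0)) (+-identityˡ 1#)
      by-cases (no  x≉0) = trans (+-cong (*-inverse x≉0) (if0-no x≉0)) (+-identityʳ 1#)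

  -- The power sum of exponent `2 ^ (j ℓ) - 1`, in a form where 0 contributes 0 even for `j = 0`.
  characterSum : ℕ → Carrier
  characterSum j = ∑ (λ x → φ (j ℕ.* ℓ) x * x ⁻¹)

  ∑-φ : ∀ m {g} → Congruent _≈_ _≈_ g → (∀ x → φ m (g x) ≈ g (φ m x)) → φ m (∑ g) ≈ ∑ g
  ∑-φ m {g} g-cong g-comm = begin
    φ m (∑ g)            ≈⟨ φ-sum m (g ∘ element) ⟩
    ∑ (λ x → φ m (g x))  ≈⟨ ∑.∑-cong g-comm ⟩
    ∑ (λ x → g (φ m x))  ≈⟨ ∑.∑-reindex (φ-cong m) (φ-injective m) g-cong ⟩
    ∑ g                  ∎

  -- Apply φ (i ℓ), which fixes characterSum j, and substitute x ⁻¹ for x.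
  characterSum-sym : ∀ i j → i ℕ.+ j ≡ k → characterSum i ≈ characterSum j
  characterSum-sym i j i+j≡k = begin
    ∑ (λ x → φ (i ℕ.* ℓ) x * x ⁻¹)
      ≈⟨ ∑.∑-cong inverted ⟨
    ∑ (λ x → x ⁻¹ * (φ (i ℕ.* ℓ) (x ⁻¹)) ⁻¹)
      ≈⟨ ∑.∑-reindex ⁻¹-cong ⁻¹-injective (λ eq → *-cong eq (⁻¹-cong (φ-cong (i ℕ.* ℓ) eq))) ⟩
    ∑ (λ x → x * (φ (i ℕ.* ℓ) x) ⁻¹)
      ≈⟨ ∑.∑-cong applied ⟨
    ∑ (λ x → φ (i ℕ.* ℓ) (φ (j ℕ.* ℓ) x * x ⁻¹))
      ≈⟨ φ-sum (i ℕ.* ℓ) ((λ x → φ (j ℕ.* ℓ) x * x ⁻¹) ∘ element) ⟨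
    φ (i ℕ.* ℓ) (characterSum j)
      ≈⟨ ∑-φ (i ℕ.* ℓ) (λ eq → *-cong (φ-cong (j ℕ.* ℓ) eq) (⁻¹-cong eq))
           (λ x → trans (φ-* (i ℕ.* ℓ) _ _) (*-cong (φ-comm (i ℕ.* ℓ) (j ℕ.* ℓ) x) (φ-⁻¹ (i ℕ.* ℓ) x))) ⟩
    characterSum j ∎
    where
    inverted : ∀ x → x ⁻¹ * (φ (i ℕ.* ℓ) (x ⁻¹)) ⁻¹ ≈ φ (i ℕ.* ℓ) x * x ⁻¹
    inverted x = trans (*-comm _ _) (*-congʳ (trans (⁻¹-cong (φ-⁻¹ (i ℕ.* ℓ) x)) (⁻¹-involutive _)))
    j*ℓ+i*ℓ≡k*ℓ : j ℕ.* ℓ ℕ.+ i ℕ.* ℓ ≡ k ℕ.* ℓ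
    j*ℓ+i*ℓ≡k*ℓ = ≡.trans (≡.sym (ℕ.*-distribʳ-+ ℓ j i)) (≡.cong (ℕ._* ℓ) (≡.trans (ℕ.+-comm j i) i+j≡k))
    -- As `i + j = k`, the outer iterate carries `φ (j ℓ) x` back to `x`.
    applied : ∀ x → φ (i ℕ.* ℓ) (φ (j ℕ.* ℓ) x * x ⁻¹) ≈ x * (φ (i ℕ.* ℓ) x) ⁻¹
    applied x = trans (φ-* (i ℕ.* ℓ) _ _) (*-cong
      (trans (φ-∘ (i ℕ.* ℓ) (j ℕ.* ℓ) x) (trans (reflexive (≡.cong (λ m → φ m x) j*ℓ+i*ℓ≡k*ℓ)) (φ-kℓ x)))
      (φ-⁻¹ (i ℕ.* ℓ) x))

  -- The sum over x of τ x / x is the sum over j < k of characterSum j, where all terms but j = 0 cancel in pairs.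
  ∑τx⁻¹≈1 : ∑ (λ x → τ x * x ⁻¹) ≈ 1#
  ∑τx⁻¹≈1 = begin
    ∑ (λ x → τ x * x ⁻¹)
      ≈⟨ ∑.∑-cong (λ x → trans (*-congʳ (τ≈sum x)) (*-distribʳ-sum {k} (x ⁻¹) (λ j → φ (toℕ j ℕ.* ℓ) x))) ⟩
    ∑ (λ x → sum {k} (λ j → φ (toℕ j ℕ.* ℓ) x * x ⁻¹))
      ≈⟨ ∑-comm (λ i (j : Fin k) → φ (toℕ j ℕ.* ℓ) (element i) * (element i) ⁻¹) ⟩
    characterSum 0 + sum {h ℕ.+ h} (λ j → characterSum (suc (toℕ j)))
      ≈⟨ +-cong (trans (∑.∑-cong {h = λ x → x * x ⁻¹} (λ x → *-congʳ (φ-zero x))) ∑xx⁻¹≈1)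
                (sum-palindrome h (characterSum ∘ suc) (λ i j eq → characterSum-sym (suc i) (suc j) (≡.cong suc (≡.trans (ℕ.+-suc i j) eq)))) ⟩
    1# + 0#  ≈⟨ +-identityʳ 1# ⟩
    1#       ∎

-- The normal form `Φ κ`

module NormalForm {c ℓ₁ ℓ₂} (F : HeytingField c ℓ₁ ℓ₂) (h ℓ : ℕ) (order : Field.HasOrder F (2 ℕ.^ suc (h ℕ.+ h)))
             (coprime : Coprime (suc (h ℕ.+ h)) ℓ) where
  open Trace F h ℓ order coprime public
  open Field F using (_≈²_)
  open import Relation.Binary.Reasoning.Setoid setoid

  -- Scaling a point by `t` multiplies both components by `norm t`. As `norm` is a bijection,
  -- collisions can be studied up to scaling.
  Φ : Carrier → Carrier × Carrier → Carrier × Carrier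
  Φ κ (x , s) = norm x + κ * norm s , σ x * s + x * σ s + norm s

  Φ-cong : ∀ {κ} → Congruent _≈²_ _≈²_ (Φ κ)
  Φ-cong (x≈ , s≈) = +-cong (norm-cong x≈) (*-congˡ (norm-cong s≈))
                   , +-cong (+-cong (*-cong (σ-cong x≈) s≈) (*-cong x≈ (σ-cong s≈))) (norm-cong s≈)

  -- The second component of `Φ κ (p , 1)`; the first is `norm p + κ`.
  G : Carrier → Carrier
  G p = σ p + p + 1#

  G-cong : Congruent _≈_ _≈_ G
  G-cong eq = +-congʳ (+-cong (σ-cong eq) eq)

  G-nonZero : ∀ p → G p ≉ 0#
  G-nonZero p eq = σx+x≉1 p (x+y≈0⇒x≈y eq)

  *-quotient : ∀ {x} y → x ≉ 0# → y ≈ y * x ⁻¹ * x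
  *-quotient {x} y x≉0 = begin
    y               ≈⟨ *-identityʳ y ⟨
    y * 1#          ≈⟨ *-congˡ (trans (*-comm _ _) (*-inverse x≉0)) ⟨
    y * (x ⁻¹ * x)  ≈⟨ *-assoc _ _ _ ⟨
    y * x ⁻¹ * x    ∎

  -- Injectivity of `Φ κ` when `σ` fixes `κ`

  module _ {κ} (σκ≈κ : σ κ ≈ κ) where

    -- (d , 1) is the difference of two points with the same image under Φ κ, and (s d + x , s) is one of them.
    no-collision : ∀ s d x → σ x + x + G s * G d ≈ 0# → σ x * d + x * σ d + G s * (norm d + κ) ≉ 0#
    no-collision s d x eq₂ eq₁ = by-cases (g ≟ 0#) (P ≟ 0#)
      where
      g P : Carrier
      g = σ d + d
      P = d * d + d + κ

      σP≈ : σ P ≈ σ d * σ d + σ d + κ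
      σP≈ = trans (σ-+ _ κ) (+-cong (trans (σ-+ _ d) (+-congʳ (σ-* d d))) σκ≈κ)

      -- Adding `d` times `eq₂` to `eq₁` eliminates `σ x`.
      xg≈ksP : x * g ≈ G s * P
      xg≈ksP = x+y≈0⇒x≈y (begin
        x * g + G s * P
          ≈⟨ solve 6 (λ x σx d σd k κ →
               x :* (σd :+ d) :+ k :* (d :* d :+ d :+ κ)
               := (σx :+ x :+ k :* (σd :+ d :+ con true)) :* d :+ (σx :* d :+ x :* σd :+ k :* (σd :* d :+ κ)))
             refl x (σ x) d (σ d) (G s) κ ⟩
        (σ x + x + G s * G d) * d + (σ x * d + x * σ d + G s * (norm d + κ))
          ≈⟨ +-cong (trans (*-congʳ eq₂) (zeroˡ d)) eq₁ ⟩
        0# + 0#  ≈⟨ +-identityˡ 0# ⟩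
        0#       ∎)

      -- Adding `σ d` times `eq₂` instead eliminates `x`. That the result contains exactly `σ P` is
      -- where `σ κ = κ` is used.
      σxg≈ksσP : σ x * g ≈ G s * σ P
      σxg≈ksσP = trans (x+y≈0⇒x≈y (begin
        σ x * g + G s * (σ d * σ d + σ d + κ)
          ≈⟨ solve 6 (λ x σx d σd k κ →
               σx :* (σd :+ d) :+ k :* (σd :* σd :+ σd :+ κ)
               := (σx :+ x :+ k :* (σd :+ d :+ con true)) :* σd :+ (σx :* d :+ x :* σd :+ k :* (σd :* d :+ κ)))
             refl x (σ x) d (σ d) (G s) κ ⟩
        (σ x + x + G s * G d) * σ d + (σ x * d + x * σ d + G s * (norm d + κ))
          ≈⟨ +-cong (trans (*-congʳ eq₂) (zeroˡ (σ d))) eq₁ ⟩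
        0# + 0#  ≈⟨ +-identityˡ 0# ⟩
        0#       ∎)) (*-congˡ (sym σP≈))

      g≉Gs : g ≉ G s
      g≉Gs eq = σx+x≉1 (d + s) (begin
        σ (d + s) + (d + s)      ≈⟨ +-congʳ (σ-+ d s) ⟩
        σ d + σ s + (d + s)      ≈⟨ solve 4 (λ a b x y → (a :+ b) :+ (x :+ y) := (a :+ x) :+ (b :+ y)) refl (σ d) (σ s) d s ⟩
        g + (σ s + s)            ≈⟨ +-congʳ eq ⟩
        G s + (σ s + s)          ≈⟨ solve 1 (λ z → z :+ con true :+ z := con true) refl (σ s + s) ⟩
        1#                       ∎)

      by-cases : Dec (g ≈ 0#) → Dec (P ≈ 0#) → _
      -- Here `G d = 1`, so `eq₂` becomes `σ x + x = G s`.
      by-cases (yes g≈0) _ = σx+x≉1 (x + s) (begin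
        σ (x + s) + (x + s)      ≈⟨ +-congʳ (σ-+ x s) ⟩
        σ x + σ s + (x + s)      ≈⟨ solve 5 (λ a b x y g → (a :+ b) :+ (x :+ y) :=
                                      (a :+ x :+ (b :+ y :+ con true) :* (g :+ con true)) :+ (b :+ y :+ con true) :* g :+ con true) refl (σ x) (σ s) x s g ⟩
        (σ x + x + G s * G d) + G s * g + 1#  ≈⟨ +-congʳ (+-cong eq₂ (trans (*-congˡ g≈0) (zeroʳ _))) ⟩
        0# + 0# + 1#             ≈⟨ trans (+-congʳ (+-identityˡ 0#)) (+-identityˡ 1#) ⟩
        1#                       ∎)
      by-cases (no g≉0) (yes P≈0) = *-nonZero (G-nonZero s) (G-nonZero d) (begin
        G s * G d             ≈⟨ +-identityˡ _ ⟨
        0# + G s * G d        ≈⟨ +-congʳ (trans (+-cong (trans (σ-cong x≈0) (φ-0 ℓ)) x≈0) (+-identityˡ 0#)) ⟨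
        σ x + x + G s * G d   ≈⟨ eq₂ ⟩
        0#                    ∎)
        where
        x≈0 : x ≈ 0#
        x≈0 = *-cancelʳ g≉0 (trans xg≈ksP (trans (*-congˡ P≈0) (trans (zeroʳ _) (sym (zeroˡ g)))))
      -- Applying `σ` to the first relation and dividing by the second shows that `σ` fixes
      -- `G s / g`, which therefore is 0 or 1; `G-nonZero` and `g≉Gs` exclude both.
      by-cases (no g≉0) (no P≉0) = [ Gs/g≉0 , Gs/g≉1 ] (σ-fixes⇒0∨1 σ[Gs/g]≈Gs/g)
        where
        σGs*g≈Gs*σg : σ (G s) * g ≈ G s * σ g
        σGs*g≈Gs*σg = *-cancelʳ (φ-nonZero ℓ P≉0) (begin
          σ (G s) * g * σ P    ≈⟨ solve 3 (λ a b c → a :* b :* c := a :* c :* b) refl (σ (G s)) g (σ P) ⟩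
          σ (G s) * σ P * g    ≈⟨ *-congʳ (trans (sym (σ-* _ _)) (trans (σ-cong (sym xg≈ksP)) (σ-* x g))) ⟩
          σ x * σ g * g        ≈⟨ solve 3 (λ a b c → a :* b :* c := a :* c :* b) refl (σ x) (σ g) g ⟩
          σ x * g * σ g        ≈⟨ *-congʳ σxg≈ksσP ⟩
          G s * σ P * σ g      ≈⟨ solve 3 (λ a b c → a :* b :* c := a :* c :* b) refl (G s) (σ P) (σ g) ⟩
          G s * σ g * σ P      ∎)

        w : Carrier
        w = G s * g ⁻¹

        w*g≈Gs : w * g ≈ G s
        w*g≈Gs = sym (*-quotient (G s) g≉0)

        σ[Gs/g]≈Gs/g : σ w ≈ w
        σ[Gs/g]≈Gs/g = *-cancelʳ (*-nonZero (φ-nonZero ℓ g≉0) g≉0) (begin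
          σ w * (σ g * g)      ≈⟨ *-assoc _ _ _ ⟨
          σ w * σ g * g        ≈⟨ *-congʳ (trans (sym (σ-* w g)) (σ-cong w*g≈Gs)) ⟩
          σ (G s) * g          ≈⟨ σGs*g≈Gs*σg ⟩
          G s * σ g            ≈⟨ *-congʳ w*g≈Gs ⟨
          w * g * σ g          ≈⟨ solve 3 (λ a b c → a :* b :* c := a :* (c :* b)) refl w g (σ g) ⟩
          w * (σ g * g)        ∎)

        Gs/g≉0 : w ≉ 0#
        Gs/g≉0 w≈0 = G-nonZero s (trans (sym w*g≈Gs) (trans (*-congʳ w≈0) (zeroˡ g)))

        Gs/g≉1 : w ≉ 1#
        Gs/g≉1 w≈1 = g≉Gs (trans (sym (*-identityˡ g)) (trans (*-congʳ (sym w≈1)) w*g≈Gs))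

    private
      -- The two components of Φ (x + d , s + e) + Φ (x , s).
      Δ₁ Δ₂ : (x d s e : Carrier) → Carrier
      Δ₁ x d s e = σ x * d + x * σ d + norm d + κ * (σ s * e + s * σ e + norm e)
      Δ₂ x d s e = σ x * e + σ d * s + σ d * e + (x * σ e + d * σ s + d * σ e) + (σ s * e + s * σ e + norm e)

      -- For `e = 0` the first difference equals `norm d * G (x / d)`, a product of nonzero factors.
      no-collision-horizontal : ∀ x d s → d ≉ 0# → Δ₁ x d s 0# ≈ 0# → Δ₂ x d s 0# ≉ 0#
      no-collision-horizontal x d s d≉0 eq₁ _ = *-nonZero (*-nonZero (φ-nonZero ℓ d≉0) d≉0) (G-nonZero w) (begin
        norm d * G w
          ≈⟨ solve 5 (λ d σd w σw t → (σd :* d) :* (σw :+ w :+ con true)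
               := (σw :* σd) :* d :+ (w :* d) :* σd :+ σd :* d) refl d (σ d) w (σ w) κ ⟩
        σ w * σ d * d + w * d * σ d + norm d
          ≈⟨ +-congʳ (+-cong (*-congʳ (trans (sym (σ-* w d)) (σ-cong (sym x≈wd)))) (*-congʳ (sym x≈wd))) ⟩
        σ x * d + x * σ d + norm d
          ≈⟨ +-identityʳ _ ⟨
        σ x * d + x * σ d + norm d + 0#
          ≈⟨ +-congˡ (sym e-terms≈0) ⟩
        Δ₁ x d s 0#  ≈⟨ eq₁ ⟩
        0#           ∎)
        where
        w : Carrier
        w = x * d ⁻¹
        x≈wd : x ≈ w * d
        x≈wd = *-quotient x d≉0
        e-terms≈0 : κ * (σ s * 0# + s * σ 0# + norm 0#) ≈ 0#
        e-terms≈0 = trans (*-congˡ (trans (+-cong (trans (+-cong (zeroʳ _) (trans (*-congˡ (φ-0 ℓ)) (zeroʳ s))) (+-identityˡ 0#)) norm-0) (+-identityˡ 0#))) (zeroʳ κ)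

      Δ-cong : ∀ {x x′ d d′ s s′ e e′} → x ≈ x′ → d ≈ d′ → s ≈ s′ → e ≈ e′ → Δ₁ x d s e ≈ Δ₁ x′ d′ s′ e′ × Δ₂ x d s e ≈ Δ₂ x′ d′ s′ e′
      Δ-cong x d s e
        = +-cong (+-cong (+-cong (*-cong (σ-cong x) d) (*-cong x (σ-cong d))) (norm-cong d)) (*-congˡ s-part)
        , +-cong (+-cong (+-cong (+-cong (*-cong (σ-cong x) e) (*-cong (σ-cong d) s)) (*-cong (σ-cong d) e))
                         (+-cong (+-cong (*-cong x (σ-cong e)) (*-cong d (σ-cong s))) (*-cong d (σ-cong e))))
                 s-part
        where s-part = +-cong (+-cong (*-cong (σ-cong s) e) (*-cong s (σ-cong e))) (norm-cong e)

      -- Dividing everything by `e` normalises the difference of the two points to `(d₁ , 1)`, at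
      -- the cost of a factor `norm e` in both components.
      no-collision-oblique : ∀ x d s e → e ≉ 0# → Δ₁ x d s e ≈ 0# → Δ₂ x d s e ≉ 0#
      no-collision-oblique x d s e e≉0 eq₁ eq₂ = no-collision s₁ d₁ x₁
        (*-cancelˡ norm-e≉0 (trans (trans (sym scaled₂) (trans (proj₂ substituted) eq₂)) (sym (zeroʳ _))))
        (*-cancelˡ norm-e≉0 (trans (trans (sym scaled₁) (trans (proj₁ substituted) eq₁)) (sym (zeroʳ _))))
        where
        s₁ d₁ x₁ : Carrier
        s₁ = s * e ⁻¹
        d₁ = d * e ⁻¹
        -- Chosen so that `x / e = s₁ * d₁ + x₁`, the parametrisation in `no-collision`.
        x₁ = s₁ * d₁ + x * e ⁻¹
        norm-e≉0 : norm e ≉ 0#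
        norm-e≉0 = *-nonZero (φ-nonZero ℓ e≉0) e≉0
        x≈ : (s₁ * d₁ + x₁) * e ≈ x
        x≈ = trans (*-congʳ (solve 2 (λ a b → a :+ (a :+ b) := b) refl (s₁ * d₁) (x * e ⁻¹))) (sym (*-quotient x e≉0))
        substituted : Δ₁ ((s₁ * d₁ + x₁) * e) (d₁ * e) (s₁ * e) e ≈ Δ₁ x d s e
                    × Δ₂ ((s₁ * d₁ + x₁) * e) (d₁ * e) (s₁ * e) e ≈ Δ₂ x d s e
        substituted = Δ-cong x≈ (sym (*-quotient d e≉0)) (sym (*-quotient s e≉0)) refl

        σx≈ : σ ((s₁ * d₁ + x₁) * e) ≈ (σ s₁ * σ d₁ + σ x₁) * σ e
        σx≈ = trans (σ-* _ e) (*-congʳ (trans (σ-+ _ x₁) (+-congʳ (σ-* s₁ d₁))))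

        scaled₁ : Δ₁ ((s₁ * d₁ + x₁) * e) (d₁ * e) (s₁ * e) e ≈ norm e * (σ x₁ * d₁ + x₁ * σ d₁ + G s₁ * (norm d₁ + κ))
        scaled₁ = begin
          _ ≈⟨ +-cong (+-cong (+-cong (*-congʳ σx≈) (*-congˡ (σ-* d₁ e))) (*-congʳ (σ-* d₁ e)))
                      (*-congˡ (+-congʳ (+-congʳ (*-congʳ (σ-* s₁ e))))) ⟩
          _ ≈⟨ solve 9 (λ s σs d σd x σx e σe κ →
                 (σs :* σd :+ σx) :* σe :* (d :* e) :+ (s :* d :+ x) :* e :* (σd :* σe) :+ σd :* σe :* (d :* e)
                   :+ κ :* (σs :* σe :* e :+ s :* e :* σe :+ σe :* e)
                 := σe :* e :* (σx :* d :+ x :* σd :+ (σs :+ s :+ con true) :* (σd :* d :+ κ)))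
               refl s₁ (σ s₁) d₁ (σ d₁) x₁ (σ x₁) e (σ e) κ ⟩
          _ ∎

        scaled₂ : Δ₂ ((s₁ * d₁ + x₁) * e) (d₁ * e) (s₁ * e) e ≈ norm e * (σ x₁ + x₁ + G s₁ * G d₁)
        scaled₂ = begin
          _ ≈⟨ +-cong (+-cong (+-cong (+-cong (*-congʳ σx≈) (*-congʳ (σ-* d₁ e))) (*-congʳ (σ-* d₁ e)))
                              (+-congʳ (+-congˡ (*-congˡ (σ-* s₁ e)))))
                      (+-congʳ (+-congʳ (*-congʳ (σ-* s₁ e)))) ⟩
          _ ≈⟨ solve 8 (λ s σs d σd x σx e σe →
                 (σs :* σd :+ σx) :* σe :* e :+ σd :* σe :* (s :* e) :+ σd :* σe :* e
                   :+ ((s :* d :+ x) :* e :* σe :+ d :* e :* (σs :* σe) :+ d :* e :* σe)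
                   :+ (σs :* σe :* e :+ s :* e :* σe :+ σe :* e)
                 := σe :* e :* (σx :+ x :+ (σs :+ s :+ con true) :* (σd :+ d :+ con true)))
               refl s₁ (σ s₁) d₁ (σ d₁) x₁ (σ x₁) e (σ e) ⟩
          _ ∎

      no-collision-Δ : ∀ x d s e → Δ₁ x d s e ≈ 0# → Δ₂ x d s e ≈ 0# → d ≈ 0# × e ≈ 0#
      no-collision-Δ x d s e eq₁ eq₂ = by-cases (d ≟ 0#) (e ≟ 0#)
        where
        by-cases : Dec (d ≈ 0#) → Dec (e ≈ 0#) → d ≈ 0# × e ≈ 0#
        by-cases _         (no e≉0)  = contradiction eq₂ (no-collision-oblique x d s e e≉0 eq₁)
        by-cases (yes d≈0) (yes e≈0) = d≈0 , e≈0
        by-cases (no d≉0)  (yes e≈0) = contradiction (trans (sym (proj₂ e→0)) eq₂)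
                                         (no-collision-horizontal x d s d≉0 (trans (sym (proj₁ e→0)) eq₁))
          where
          e→0 : Δ₁ x d s e ≈ Δ₁ x d s 0# × Δ₂ x d s e ≈ Δ₂ x d s 0#
          e→0 = Δ-cong refl refl refl e≈0

    Φ-injective : Injective _≈²_ _≈²_ (Φ κ)
    Φ-injective {x , s} {x′ , s′} (eq₁ , eq₂) = x+y≈0⇒x≈y (proj₁ d≈0×e≈0) , x+y≈0⇒x≈y (proj₂ d≈0×e≈0)
      where
      d≈0×e≈0 : x + x′ ≈ 0# × s + s′ ≈ 0#
      d≈0×e≈0 = no-collision-Δ x (x + x′) s (s + s′)
        (begin
          _ ≈⟨ +-cong (+-congʳ (+-congˡ (*-congˡ (σ-+ x x′)))) (*-congˡ (+-congʳ (+-congˡ (*-congˡ (σ-+ s s′))))) ⟩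
          _ ≈⟨ +-congʳ (+-congˡ (*-congʳ (σ-+ x x′))) ⟩
          _ ≈⟨ +-congˡ (*-congˡ (+-congˡ (*-congʳ (σ-+ s s′)))) ⟩
          _ ≈⟨ solve 9 (λ x σx s σs x′ σx′ s′ σs′ κ →
                 σx :* (x :+ x′) :+ x :* (σx :+ σx′) :+ (σx :+ σx′) :* (x :+ x′)
                   :+ κ :* (σs :* (s :+ s′) :+ s :* (σs :+ σs′) :+ (σs :+ σs′) :* (s :+ s′))
                 := (σx :* x :+ κ :* (σs :* s)) :+ (σx′ :* x′ :+ κ :* (σs′ :* s′)))
               refl x (σ x) s (σ s) x′ (σ x′) s′ (σ s′) κ ⟩
          _ ≈⟨ x≈y⇒x+y≈0 eq₁ ⟩
          0# ∎)
        (begin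
          _ ≈⟨ +-cong (+-cong (+-cong (+-congˡ (*-congʳ (σ-+ x x′))) (*-congʳ (σ-+ x x′)))
                              (+-cong (+-congʳ (*-congˡ (σ-+ s s′))) (*-congˡ (σ-+ s s′))))
                      (+-cong (+-congˡ (*-congˡ (σ-+ s s′))) (*-congʳ (σ-+ s s′))) ⟩
          _ ≈⟨ solve 8 (λ x σx s σs x′ σx′ s′ σs′ →
                 σx :* (s :+ s′) :+ (σx :+ σx′) :* s :+ (σx :+ σx′) :* (s :+ s′)
                   :+ (x :* (σs :+ σs′) :+ (x :+ x′) :* σs :+ (x :+ x′) :* (σs :+ σs′))
                   :+ (σs :* (s :+ s′) :+ s :* (σs :+ σs′) :+ (σs :+ σs′) :* (s :+ s′))
                 := (σx :* s :+ x :* σs :+ σs :* s) :+ (σx′ :* s′ :+ x′ :* σs′ :+ σs′ :* s′))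
               refl x (σ x) s (σ s) x′ (σ x′) s′ (σ s′) ⟩
          _ ≈⟨ x≈y⇒x+y≈0 eq₂ ⟩
          0# ∎)

  -- Necessity of `σ κ = κ`

  f : Carrier → Carrier → Carrier
  f κ p = (norm p + κ) * G p ⁻¹

  v : Carrier → Carrier → Carrier
  v κ p = (p * p + p + κ) * G p ⁻¹

  f-cong : ∀ {κ} → Congruent _≈_ _≈_ (f κ)
  f-cong eq = *-cong (+-congʳ (norm-cong eq)) (⁻¹-cong (G-cong eq))

  f≈p+v : ∀ κ p → f κ p ≈ p + v κ p
  f≈p+v κ p = begin
    (norm p + κ) * G p ⁻¹
      ≈⟨ *-congʳ (solve 3 (λ p σp κ → σp :* p :+ κ := p :* (σp :+ p :+ con true) :+ (p :* p :+ p :+ κ)) refl p (σ p) κ) ⟩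
    (p * G p + (p * p + p + κ)) * G p ⁻¹
      ≈⟨ distribʳ _ _ _ ⟩
    p * G p * G p ⁻¹ + v κ p
      ≈⟨ +-congʳ (trans (*-assoc _ _ _) (trans (*-congˡ (*-inverse (G-nonZero p))) (*-identityʳ p))) ⟩
    p + v κ p ∎

  G-+1 : ∀ p → G (p + 1#) ≈ G p
  G-+1 p = begin
    σ (p + 1#) + (p + 1#) + 1#   ≈⟨ +-congʳ (+-congʳ (trans (σ-+ p 1#) (+-congˡ σ-1))) ⟩
    σ p + 1# + (p + 1#) + 1#     ≈⟨ solve 2 (λ p σp → σp :+ con true :+ (p :+ con true) :+ con true := σp :+ p :+ con true) refl p (σ p) ⟩
    G p                          ∎

  v-+1 : ∀ κ p → v κ (p + 1#) ≈ v κ p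
  v-+1 κ p = *-cong
    (solve 2 (λ p κ → (p :+ con true) :* (p :+ con true) :+ (p :+ con true) :+ κ := p :* p :+ p :+ κ) refl p κ)
    (⁻¹-cong (G-+1 p))

  f-+1 : ∀ κ p → f κ (p + 1#) ≈ f κ p + 1#
  f-+1 κ p = begin
    f κ (p + 1#)             ≈⟨ f≈p+v κ (p + 1#) ⟩
    p + 1# + v κ (p + 1#)    ≈⟨ +-congˡ (v-+1 κ p) ⟩
    p + 1# + v κ p           ≈⟨ solve 2 (λ p v → p :+ con true :+ v := p :+ v :+ con true) refl p (v κ p) ⟩
    p + v κ p + 1#           ≈⟨ +-congʳ (f≈p+v κ p) ⟨
    f κ p + 1#               ∎

  -- Equal ratios become equal images after scaling: with `norm t = G p / G p′`, the points
  -- `(t * p′ , t)` and `(p , 1)` collide, which forces `t = 1`.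
  Φ-injective⇒f-injective : ∀ {κ} → Injective _≈²_ _≈²_ (Φ κ) → Injective _≈_ _≈_ (f κ)
  Φ-injective⇒f-injective {κ} inj {p} {p′} fp≈fp′ = begin
    p        ≈⟨ proj₁ collapsed ⟩
    t * p′   ≈⟨ *-congʳ (proj₂ collapsed) ⟨
    1# * p′  ≈⟨ *-identityˡ p′ ⟩
    p′       ∎
    where
    root : ∃ λ t → norm t ≈ G p * G p′ ⁻¹
    root = norm-surjective (G p * G p′ ⁻¹)
    t : Carrier
    t = proj₁ root
    norm-t*G : norm t * G p′ ≈ G p
    norm-t*G = trans (*-congʳ (proj₂ root)) (sym (*-quotient (G p) (G-nonZero p′)))
    Φ₁-scaled : norm (t * p′) + κ * norm t ≈ norm p + κ * norm 1#
    Φ₁-scaled = begin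
      norm (t * p′) + κ * norm t        ≈⟨ +-cong (norm-* t p′) (*-comm κ (norm t)) ⟩
      norm t * norm p′ + norm t * κ     ≈⟨ distribˡ _ _ _ ⟨
      norm t * (norm p′ + κ)            ≈⟨ *-congˡ (*-quotient (norm p′ + κ) (G-nonZero p′)) ⟩
      norm t * (f κ p′ * G p′)          ≈⟨ solve 3 (λ a b c → a :* (b :* c) := (a :* c) :* b) refl (norm t) (f κ p′) (G p′) ⟩
      norm t * G p′ * f κ p′            ≈⟨ *-cong norm-t*G (sym fp≈fp′) ⟩
      G p * f κ p                       ≈⟨ *-comm _ _ ⟩
      f κ p * G p                       ≈⟨ *-quotient (norm p + κ) (G-nonZero p) ⟨
      norm p + κ                        ≈⟨ +-congˡ (trans (*-congˡ (trans (*-identityʳ _) σ-1)) (*-identityʳ κ)) ⟨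
      norm p + κ * norm 1#              ∎
    Φ₂-scaled : σ (t * p′) * t + t * p′ * σ t + norm t ≈ σ p * 1# + p * σ 1# + norm 1#
    Φ₂-scaled = begin
      σ (t * p′) * t + t * p′ * σ t + norm t   ≈⟨ +-congʳ (+-congʳ (*-congʳ (σ-* t p′))) ⟩
      σ t * σ p′ * t + t * p′ * σ t + norm t
        ≈⟨ solve 4 (λ t σt p σp → σt :* σp :* t :+ t :* p :* σt :+ σt :* t := σt :* t :* (σp :+ p :+ con true)) refl t (σ t) p′ (σ p′) ⟩
      norm t * G p′                            ≈⟨ norm-t*G ⟩
      σ p + p + 1#                             ≈⟨ +-cong (+-cong (*-identityʳ _) (trans (*-congˡ σ-1) (*-identityʳ p))) (trans (*-identityʳ _) σ-1) ⟨
      σ p * 1# + p * σ 1# + norm 1#            ∎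
    collapsed : p ≈ t * p′ × 1# ≈ t
    collapsed = inj (sym Φ₁-scaled , sym Φ₂-scaled)

  -- Since τ (p + 1) = τ p + 1, the sum is ∑ τ p w(p) + ∑ τ (p + 1) w(p + 1).
  ∑-periodic≈0 : ∀ {w} → Congruent _≈_ _≈_ w → (∀ p → w (p + 1#) ≈ w p) → ∑ w ≈ 0#
  ∑-periodic≈0 {w} w-cong w-+1 = begin
    ∑ w                                      ≈⟨ ∑.∑-cong split ⟩
    ∑ (λ p → g p + g (p + 1#))               ≈⟨ ∑.∑-distrib g (λ p → g (p + 1#)) ⟩
    ∑ g + ∑ (λ p → g (p + 1#))               ≈⟨ +-congˡ (∑.∑-reindex +-congʳ +1-injective g-cong) ⟩
    ∑ g + ∑ g                                ≈⟨ x+x≈0 (∑ g) ⟩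
    0#                                       ∎
    where
    g : Carrier → Carrier
    g p = τ p * w p
    g-cong : Congruent _≈_ _≈_ g
    g-cong eq = *-cong (τ-cong eq) (w-cong eq)
    +1-injective : Injective _≈_ _≈_ (_+ 1#)
    +1-injective {x} {y} eq = trans (x≈x+y+y x 1#) (trans (+-congʳ eq) (sym (x≈x+y+y y 1#)))
    split : ∀ p → w p ≈ g p + g (p + 1#)
    split p = sym (begin
      τ p * w p + τ (p + 1#) * w (p + 1#)  ≈⟨ +-congˡ (*-cong (τ-[x+1] p) (w-+1 p)) ⟩
      τ p * w p + (τ p + 1#) * w p         ≈⟨ solve 2 (λ t w → t :* w :+ (t :+ con true) :* w := w) refl (τ p) (w p) ⟩
      w p                                  ∎)

  module _ {κ} (f-injective : Injective _≈_ _≈_ (f κ)) where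

    private
      -- Not the map of the theorem, but the additive map whose kernel is `{0, 1}`.
      ψ : Carrier → Carrier
      ψ t = σ t + t

      ψ-cong : Congruent _≈_ _≈_ ψ
      ψ-cong eq = +-cong (σ-cong eq) eq

      ψ-+ : ∀ x y → ψ (x + y) ≈ ψ x + ψ y
      ψ-+ x y = trans (+-congʳ (σ-+ x y)) (solve 4 (λ a b x y → a :+ b :+ (x :+ y) := a :+ x :+ (b :+ y)) refl (σ x) (σ y) x y)

      ψ-+1 : ∀ x → ψ (x + 1#) ≈ ψ x
      ψ-+1 x = trans (ψ-+ x 1#) (trans (+-congˡ (x≈y⇒x+y≈0 σ-1)) (+-identityʳ _))

    -- f permutes the field and τ can be replaced by τ ∘ f, their difference being 1-periodic.
    ∑τ[ψ∘f]≈∑τψ : ∑ (λ p → τ p * ψ (f κ p)) ≈ ∑ (λ p → τ p * ψ p)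
    ∑τ[ψ∘f]≈∑τψ = trans
      (x+y≈0⇒x≈y (begin
        ∑ (λ p → τ p * ψ (f κ p)) + ∑ (λ p → τ (f κ p) * ψ (f κ p))
          ≈⟨ ∑.∑-distrib (λ p → τ p * ψ (f κ p)) (λ p → τ (f κ p) * ψ (f κ p)) ⟨
        ∑ (λ p → τ p * ψ (f κ p) + τ (f κ p) * ψ (f κ p))
          ≈⟨ ∑.∑-cong (λ p → distribʳ (ψ (f κ p)) (τ p) (τ (f κ p))) ⟨
        ∑ (λ p → (τ p + τ (f κ p)) * ψ (f κ p))
          ≈⟨ ∑-periodic≈0 {λ p → (τ p + τ (f κ p)) * ψ (f κ p)}
               (λ eq → *-cong (+-cong (τ-cong eq) (τ-cong (f-cong eq))) (ψ-cong (f-cong eq))) periodic ⟩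
        0# ∎))
      (∑.∑-reindex f-cong f-injective (λ eq → *-cong (τ-cong eq) (ψ-cong eq)))
      where
      periodic : ∀ p → (τ (p + 1#) + τ (f κ (p + 1#))) * ψ (f κ (p + 1#)) ≈ (τ p + τ (f κ p)) * ψ (f κ p)
      periodic p = *-cong
        (trans (+-cong (τ-[x+1] p) (trans (τ-cong (f-+1 κ p)) (τ-[x+1] (f κ p))))
               (solve 2 (λ a b → a :+ con true :+ (b :+ con true) := a :+ b) refl (τ p) (τ (f κ p))))
        (trans (ψ-cong (f-+1 κ p)) (ψ-+1 (f κ p)))

    -- As `σ` fixes `τ p`, the difference of the two sides is the sum of `τ p * ψ (v κ p)`, and
    -- additivity gives `ψ (v κ p) = ψ (f κ p) + ψ p`.
    σ-fixes-∑τv : σ (∑ (λ p → τ p * v κ p)) ≈ ∑ (λ p → τ p * v κ p)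
    σ-fixes-∑τv = x+y≈0⇒x≈y (begin
      σ (∑ τv) + ∑ τv                     ≈⟨ +-congʳ (φ-sum ℓ (τv ∘ element)) ⟩
      ∑ (λ p → σ (τv p)) + ∑ τv           ≈⟨ ∑.∑-distrib (λ p → σ (τv p)) τv ⟨
      ∑ (λ p → σ (τv p) + τv p)           ≈⟨ ∑.∑-cong expand ⟩
      ∑ (λ p → τ p * ψ (f κ p) + τ p * ψ p)  ≈⟨ ∑.∑-distrib (λ p → τ p * ψ (f κ p)) (λ p → τ p * ψ p) ⟩
      ∑ (λ p → τ p * ψ (f κ p)) + ∑ (λ p → τ p * ψ p)  ≈⟨ x≈y⇒x+y≈0 ∑τ[ψ∘f]≈∑τψ ⟩
      0# ∎)
      where
      τv : Carrier → Carrier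
      τv p = τ p * v κ p
      expand : ∀ p → σ (τv p) + τv p ≈ τ p * ψ (f κ p) + τ p * ψ p
      expand p = begin
        σ (τ p * v κ p) + τ p * v κ p    ≈⟨ +-congʳ (trans (σ-* _ _) (*-congʳ (trans (σ-τ p) (τ-σ p)))) ⟩
        τ p * σ (v κ p) + τ p * v κ p    ≈⟨ solve 4 (λ t v σv ψ → t :* σv :+ t :* v := t :* (ψ :+ (σv :+ v)) :+ t :* ψ) refl (τ p) (v κ p) (σ (v κ p)) (ψ p) ⟩
        τ p * (ψ p + ψ (v κ p)) + τ p * ψ p   ≈⟨ +-congʳ (*-congˡ (trans (ψ-cong (f≈p+v κ p)) (ψ-+ p (v κ p)))) ⟨
        τ p * ψ (f κ p) + τ p * ψ p      ∎

    private
      s₀ s₁ : Carrier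
      s₀ = ∑ (λ p → τ p * G p ⁻¹)
      s₁ = ∑ (λ p → τ p * ((p * p + p) * G p ⁻¹))

      σ-G⁻¹ : ∀ p → σ (G p ⁻¹) ≈ G (σ p) ⁻¹
      σ-G⁻¹ p = trans (φ-⁻¹ ℓ (G p)) (⁻¹-cong (trans (σ-+ _ 1#) (+-cong (σ-+ _ p) σ-1)))

      -- The summand is built from `p` by operations that commute with `σ`, so `σ` merely permutes
      -- the terms.
      σ-fixes-s₁ : σ s₁ ≈ s₁
      σ-fixes-s₁ = ∑-φ ℓ {λ p → τ p * ((p * p + p) * G p ⁻¹)}
        (λ eq → *-cong (τ-cong eq) (*-cong (+-cong (*-cong eq eq) eq) (⁻¹-cong (G-cong eq))))
        (λ p → trans (σ-* _ _) (*-cong (σ-τ p) (trans (σ-* _ _) (*-cong (trans (σ-+ _ p) (+-congʳ (σ-* p p))) (σ-G⁻¹ p)))))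

      -- Where `τ p = 1`, `G p` is `θ p`; elsewhere both terms vanish. Reindexing by the
      -- trace-preserving bijection `θ` leaves the sum of `τ x / x`.
      s₀≈1 : s₀ ≈ 1#
      s₀≈1 = begin
        ∑ (λ p → τ p * G p ⁻¹)            ≈⟨ ∑.∑-cong (λ p → G→θ p (τ≈0∨1 p)) ⟩
        ∑ (λ p → τ (θ p) * (θ p) ⁻¹)      ≈⟨ ∑.∑-reindex θ-cong θ-injective (λ eq → *-cong (τ-cong eq) (⁻¹-cong eq)) ⟩
        ∑ (λ x → τ x * x ⁻¹)              ≈⟨ ∑τx⁻¹≈1 ⟩
        1#                                ∎
        where
        G→θ : ∀ p → τ p ≈ 0# ⊎ τ p ≈ 1# → τ p * G p ⁻¹ ≈ τ (θ p) * (θ p) ⁻¹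
        G→θ p (inj₁ τp≈0) = trans (trans (*-congʳ τp≈0) (zeroˡ _)) (sym (trans (*-congʳ (trans (τ-θ p) τp≈0)) (zeroˡ _)))
        G→θ p (inj₂ τp≈1) = *-cong (sym (τ-θ p)) (⁻¹-cong (+-congˡ (sym τp≈1)))

      ∑τv≈s₁+κ : ∑ (λ p → τ p * v κ p) ≈ s₁ + κ
      ∑τv≈s₁+κ = begin
        ∑ (λ p → τ p * v κ p)
          ≈⟨ ∑.∑-cong (λ p → solve 4 (λ t q κ g → t :* ((q :+ κ) :* g) := t :* (q :* g) :+ κ :* (t :* g)) refl (τ p) (p * p + p) κ (G p ⁻¹)) ⟩
        ∑ (λ p → τ p * ((p * p + p) * G p ⁻¹) + κ * (τ p * G p ⁻¹))
          ≈⟨ ∑.∑-distrib (λ p → τ p * ((p * p + p) * G p ⁻¹)) (λ p → κ * (τ p * G p ⁻¹)) ⟩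
        s₁ + ∑ (λ p → κ * (τ p * G p ⁻¹))
          ≈⟨ +-congˡ (sym (*-distribˡ-sum κ (λ i → τ (element i) * G (element i) ⁻¹))) ⟩
        s₁ + κ * s₀
          ≈⟨ +-congˡ (trans (*-congˡ s₀≈1) (*-identityʳ κ)) ⟩
        s₁ + κ ∎

    f-injective⇒σκ≈κ : σ κ ≈ κ
    f-injective⇒σκ≈κ = begin
      σ κ              ≈⟨ solve 2 (λ a b → a := b :+ (b :+ a)) refl (σ κ) s₁ ⟩
      s₁ + (s₁ + σ κ)  ≈⟨ +-congˡ (trans (+-congʳ (sym σ-fixes-s₁)) (sym (σ-+ s₁ κ))) ⟩
      s₁ + σ (s₁ + κ)  ≈⟨ +-congˡ (trans (σ-cong (sym ∑τv≈s₁+κ)) (trans σ-fixes-∑τv ∑τv≈s₁+κ)) ⟩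
      s₁ + (s₁ + κ)    ≈⟨ solve 2 (λ a b → b :+ (b :+ a) := a) refl κ s₁ ⟩
      κ                ∎

-- Reduction of `ψ` to the normal form

module Butterfly {c ℓ₁ ℓ₂} (F : HeytingField c ℓ₁ ℓ₂) (h ℓ : ℕ) (order : Field.HasOrder F (2 ℕ.^ suc (h ℕ.+ h)))
             (coprime : Coprime (suc (h ℕ.+ h)) ℓ) (α β : Field.Carrier F) where
  open NormalForm F h ℓ order coprime hiding (v)
  open Field F using (_≈²_; Permutes²) renaming (R to R′; ψ to ψ′; e to e′; u to u′; v to v′)
  open import Relation.Binary.Reasoning.Setoid setoid

  Q : ℕ
  Q = 2 ℕ.^ ℓ

  R : Carrier → Carrier → Carrier
  R = R′ Q α β

  ψ : Carrier × Carrier → Carrier × Carrier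
  ψ = ψ′ Q α β

  e u v : Carrier
  e = e′ Q α β
  u = u′ Q α β
  v = v′ Q α β

  x^Q≈σ : ∀ x → x ^ Q ≈ σ x
  x^Q≈σ x = sym (φ≈^ ℓ x)

  x^[Q+1]≈norm : ∀ x → x ^ (Q ℕ.+ 1) ≈ norm x
  x^[Q+1]≈norm x = trans (^-homo-* x Q 1) (*-cong (x^Q≈σ x) (*-identityʳ x))

  x^[Q+2] : ∀ x → x ^ (Q ℕ.+ 2) ≈ σ x * x * x
  x^[Q+2] x = trans (^-homo-* x Q 2) (trans (*-cong (x^Q≈σ x) (*-congˡ (*-identityʳ x))) (sym (*-assoc _ _ _)))

  x^2Q : ∀ x → x ^ (2 ℕ.* Q) ≈ σ x * σ x
  x^2Q x = trans (^-homo-* x Q (Q ℕ.+ 0)) (*-cong (x^Q≈σ x) (trans (^-congʳ x (ℕ.+-identityʳ Q)) (x^Q≈σ x)))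

  x^[2Q+1] : ∀ x → x ^ (2 ℕ.* Q ℕ.+ 1) ≈ σ x * σ x * x
  x^[2Q+1] x = trans (^-homo-* x (2 ℕ.* Q) 1) (*-cong (x^2Q x) (*-identityʳ x))

  x^[2Q+2] : ∀ x → x ^ (2 ℕ.* Q ℕ.+ 2) ≈ norm x * norm x
  x^[2Q+2] x = begin
    x ^ (2 ℕ.* Q ℕ.+ 2)      ≈⟨ ^-homo-* x (2 ℕ.* Q) 2 ⟩
    x ^ (2 ℕ.* Q) * x ^ 2    ≈⟨ *-cong (x^2Q x) (*-congˡ (*-identityʳ x)) ⟩
    σ x * σ x * (x * x)      ≈⟨ solve 2 (λ x σx → σx :* σx :* (x :* x) := σx :* x :* (σx :* x)) refl x (σ x) ⟩
    norm x * norm x          ∎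

  -- `δ` is the coefficient of `R` on the diagonal: `R y y = δ * norm y`.
  A σA B δ : Carrier
  A  = α + 1#
  σA = σ α + 1#
  B  = norm β
  δ  = σA * A + B

  σ[α+1] : σ A ≈ σA
  σ[α+1] = trans (σ-+ α 1#) (+-congˡ σ-1)

  R≈ : ∀ x y → R x y ≈ (σ x + (σA + 1#) * σ y) * (x + (A + 1#) * y) + B * (σ y * y)
  R≈ x y = begin
    R x y                              ≈⟨ +-cong (x^[Q+1]≈norm (x + α * y)) (x^[Q+1]≈norm (β * y)) ⟩
    norm (x + α * y) + norm (β * y)    ≈⟨ +-cong (*-congʳ (trans (σ-+ x _) (+-congˡ (σ-* α y)))) (norm-* β y) ⟩
    (σ x + σ α * σ y) * (x + α * y) + B * norm y
      ≈⟨ +-congʳ (*-cong (+-congˡ (*-congʳ (x≈x+y+y (σ α) 1#))) (+-congˡ (*-congʳ (x≈x+y+y α 1#)))) ⟩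
    (σ x + (σA + 1#) * σ y) * (x + (A + 1#) * y) + B * (σ y * y) ∎

  R-cong : ∀ {x x′ y y′} → x ≈ x′ → y ≈ y′ → R x y ≈ R x′ y′
  R-cong x≈ y≈ = +-cong (^-congˡ (Q ℕ.+ 1) (+-cong x≈ (*-congˡ y≈))) (^-congˡ (Q ℕ.+ 1) (*-congˡ y≈))

  ψ-cong : Congruent _≈²_ _≈²_ ψ
  ψ-cong (x≈ , y≈) = R-cong x≈ y≈ , R-cong y≈ x≈

  e≈δ² : e ≈ δ * δ
  e≈δ² = begin
    e  ≈⟨ +-cong (x^[2Q+2] A) (x^[2Q+2] β) ⟩
    norm A * norm A + B * B          ≈⟨ +-congʳ (*-cong (*-congʳ σ[α+1]) (*-congʳ σ[α+1])) ⟩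
    σA * A * (σA * A) + B * B        ≈⟨ solve 2 (λ a b → a :* a :+ b :* b := (a :+ b) :* (a :+ b)) refl (σA * A) B ⟩
    δ * δ                            ∎

  -- In this shape division by `e = δ²` leaves a polynomial in `σA / δ` and `B / δ²`.
  u≈ : u ≈ δ * δ + σA * σA + δ * σA + B
  u≈ = begin
    u ≈⟨ +-cong (+-cong (+-congʳ (+-cong (trans (x^[2Q+2] A) (*-cong (*-congʳ σ[α+1]) (*-congʳ σ[α+1]))) (x^[2Q+1] α)))
                        (*-cong (x^Q≈σ α) (x^[Q+1]≈norm β)))
                (x^[2Q+2] β) ⟩
    σA * A * (σA * A) + σ α * σ α * α + α + σ α * B + B * B
      ≈⟨ solve 3 (λ α σα B →
           let A = α :+ con true ; σA = σα :+ con true ; δ = σA :* A :+ B in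
           σA :* A :* (σA :* A) :+ σα :* σα :* α :+ α :+ σα :* B :+ B :* B
           := δ :* δ :+ σA :* σA :+ δ :* σA :+ B) refl α (σ α) B ⟩
    δ * δ + σA * σA + δ * σA + B ∎

  v≈ : v ≈ δ * δ + A * A + δ * A + B
  v≈ = begin
    v ≈⟨ +-cong (+-cong (+-cong (+-cong (trans (x^[2Q+2] A) (*-cong (*-congʳ σ[α+1]) (*-congʳ σ[α+1]))) (x^[Q+2] α)) (x^Q≈σ α))
                        (*-congˡ (x^[Q+1]≈norm β)))
                (x^[2Q+2] β) ⟩
    σA * A * (σA * A) + σ α * α * α + σ α + α * B + B * B
      ≈⟨ solve 3 (λ α σα B →
           let A = α :+ con true ; σA = σα :+ con true ; δ = σA :* A :+ B in
           σA :* A :* (σA :* A) :+ σα :* α :* α :+ σα :+ α :* B :+ B :* B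
           := δ :* δ :+ A :* A :+ δ :* A :+ B) refl α (σ α) B ⟩
    δ * δ + A * A + δ * A + B ∎

  δ≈0⇒β≈α+1 : δ ≈ 0# → β ≈ α + 1#
  δ≈0⇒β≈α+1 δ≈0 = norm-injective (sym (trans (*-congʳ σ[α+1]) (x+y≈0⇒x≈y δ≈0)))

  -- When β = α + 1, the points (1 , 0) and (1 + β ⁻¹ , β ⁻¹) have the same image.
  β≈α+1⇒¬ψ-injective : β ≉ 0# → β ≈ α + 1# → ¬ Injective _≈²_ _≈²_ ψ
  β≈α+1⇒¬ψ-injective β≉0 β≈A inj = ⁻¹-nonZero β≉0 (sym (proj₂ (inj {1# , 0#} {1# + g , g} (eq₁ , eq₂))))
    where
    g : Carrier
    g = β ⁻¹
    βg≈1 : β * g ≈ 1#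
    βg≈1 = *-inverse β≉0
    [α+1]g≈1 : (α + 1#) * g ≈ 1#
    [α+1]g≈1 = trans (*-congʳ (sym β≈A)) βg≈1
    α≈β+1 : α ≈ β + 1#
    α≈β+1 = trans (x≈x+y+y α 1#) (+-congʳ (sym β≈A))
    R-≈ : ∀ {x y X Y} → x + α * y ≈ X → β * y ≈ Y → R x y ≈ norm X + norm Y
    R-≈ eqX eqY = +-cong (trans (x^[Q+1]≈norm _) (norm-cong eqX)) (trans (x^[Q+1]≈norm _) (norm-cong eqY))
    eq₁ : R 1# 0# ≈ R (1# + g) g
    eq₁ = begin
      R 1# 0#               ≈⟨ R-≈ (trans (+-congˡ (zeroʳ α)) (+-identityʳ 1#)) (zeroʳ β) ⟩
      norm 1# + norm 0#     ≈⟨ +-comm _ _ ⟩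
      norm 0# + norm 1#     ≈⟨ R-≈ (begin
        1# + g + α * g        ≈⟨ solve 2 (λ α g → con true :+ g :+ α :* g := con true :+ (α :+ con true) :* g) refl α g ⟩
        1# + (α + 1#) * g     ≈⟨ +-congˡ [α+1]g≈1 ⟩
        1# + 1#               ≈⟨ 1+1≈0 ⟩
        0#                    ∎) βg≈1 ⟨
      R (1# + g) g          ∎
    eq₂ : R 0# 1# ≈ R g (1# + g)
    eq₂ = begin
      R 0# 1#               ≈⟨ R-≈ (trans (+-identityˡ _) (*-identityʳ α)) (*-identityʳ β) ⟩
      norm α + norm β       ≈⟨ +-comm _ _ ⟩
      norm β + norm α       ≈⟨ R-≈ (begin
        g + α * (1# + g)      ≈⟨ solve 2 (λ α g → g :+ α :* (con true :+ g) := α :+ (α :+ con true) :* g) refl α g ⟩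
        α + (α + 1#) * g      ≈⟨ +-congˡ [α+1]g≈1 ⟩
        α + 1#                ≈⟨ β≈A ⟨
        β                     ∎) (begin
        β * (1# + g)          ≈⟨ solve 2 (λ β g → β :* (con true :+ g) := β :+ β :* g) refl β g ⟩
        β + β * g             ≈⟨ +-congˡ βg≈1 ⟩
        β + 1#                ≈⟨ α≈β+1 ⟨
        α                     ∎) ⟨
      R g (1# + g)          ∎

  module _ (δ≉0 : δ ≉ 0#) where

    -- In general `a′` is not `σ a`, because `σ` may move `δ`. This `κ` is not yet the parameter of
    -- the normal form; that is `K b`.
    a a′ κ : Carrier
    a  = A * δ ⁻¹
    a′ = σA * δ ⁻¹
    κ  = B * δ ⁻¹ * δ ⁻¹

    A≈aδ : A ≈ a * δ
    A≈aδ = *-quotient A δ≉0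

    σA≈a′δ : σA ≈ a′ * δ
    σA≈a′δ = *-quotient σA δ≉0

    B≈κδδ : B ≈ κ * δ * δ
    B≈κδδ = trans (*-quotient B δ≉0) (*-congʳ (*-quotient (B * δ ⁻¹) δ≉0))

    -- The definition of `δ` divided by `δ`. The later polynomial identities hold only modulo this
    -- relation.
    δ[aa′+κ]≈1 : δ * (a * a′ + κ) ≈ 1#
    δ[aa′+κ]≈1 = *-cancelˡ δ≉0 (begin
      δ * (δ * (a * a′ + κ))          ≈⟨ solve 4 (λ δ a a′ κ → δ :* (δ :* (a :* a′ :+ κ)) := a′ :* δ :* (a :* δ) :+ κ :* δ :* δ) refl δ a a′ κ ⟩
      a′ * δ * (a * δ) + κ * δ * δ    ≈⟨ +-cong (*-cong σA≈a′δ A≈aδ) B≈κδδ ⟨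
      δ                               ≈⟨ *-identityʳ δ ⟨
      δ * 1#                          ∎)

    e≉0 : e ≉ 0#
    e≉0 e≈0 = *-nonZero δ≉0 δ≉0 (trans (sym e≈δ²) e≈0)

    -- These are `u / e` and `v / e`. As `e ^ (Q ∸ 1)` is `σ e / e`, the condition becomes
    -- `σ u₁ = v₁`.
    u₁ v₁ : Carrier
    u₁ = 1# + a′ * a′ + a′ + κ
    v₁ = 1# + a * a + a + κ

    u≈e*u₁ : u ≈ e * u₁
    u≈e*u₁ = begin
      u                                            ≈⟨ u≈ ⟩
      δ * δ + σA * σA + δ * σA + B                 ≈⟨ +-cong (+-cong (+-congˡ (*-cong σA≈a′δ σA≈a′δ)) (*-congˡ σA≈a′δ)) B≈κδδ ⟩
      δ * δ + a′ * δ * (a′ * δ) + δ * (a′ * δ) + κ * δ * δ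
        ≈⟨ solve 3 (λ δ a κ → δ :* δ :+ a :* δ :* (a :* δ) :+ δ :* (a :* δ) :+ κ :* δ :* δ
                            := δ :* δ :* (con true :+ a :* a :+ a :+ κ)) refl δ a′ κ ⟩
      δ * δ * u₁                                   ≈⟨ *-congʳ e≈δ² ⟨
      e * u₁                                       ∎

    v≈e*v₁ : v ≈ e * v₁
    v≈e*v₁ = begin
      v                                            ≈⟨ v≈ ⟩
      δ * δ + A * A + δ * A + B                    ≈⟨ +-cong (+-cong (+-congˡ (*-cong A≈aδ A≈aδ)) (*-congˡ A≈aδ)) B≈κδδ ⟩
      δ * δ + a * δ * (a * δ) + δ * (a * δ) + κ * δ * δ
        ≈⟨ solve 3 (λ δ a κ → δ :* δ :+ a :* δ :* (a :* δ) :+ δ :* (a :* δ) :+ κ :* δ :* δ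
                            := δ :* δ :* (con true :+ a :* a :+ a :+ κ)) refl δ a κ ⟩
      δ * δ * v₁                                   ≈⟨ *-congʳ e≈δ² ⟨
      e * v₁                                       ∎

    e^[Q-1]*e≈σe : e ^ (Q ∸ 1) * e ≈ σ e
    e^[Q-1]*e≈σe = begin
      e ^ (Q ∸ 1) * e       ≈⟨ *-comm _ _ ⟩
      e ^ suc (Q ∸ 1)       ≈⟨ ^-congʳ e (ℕ.m+[n∸m]≡n (ℕ.m^n>0 2 ℓ)) ⟩
      e ^ Q                 ≈⟨ x^Q≈σ e ⟩
      σ e                   ∎

    u^Q≈ : u ^ Q ≈ σ e * σ u₁
    u^Q≈ = trans (x^Q≈σ u) (trans (σ-cong u≈e*u₁) (σ-* e u₁))

    e^[Q-1]v≈ : e ^ (Q ∸ 1) * v ≈ σ e * v₁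
    e^[Q-1]v≈ = trans (*-congˡ v≈e*v₁) (trans (sym (*-assoc _ _ _)) (*-congʳ e^[Q-1]*e≈σe))

    condition⇒σu₁≈v₁ : u ^ Q ≈ e ^ (Q ∸ 1) * v → σ u₁ ≈ v₁
    condition⇒σu₁≈v₁ eq = *-cancelˡ (φ-nonZero ℓ e≉0) (trans (sym u^Q≈) (trans eq e^[Q-1]v≈))

    σu₁≈v₁⇒condition : σ u₁ ≈ v₁ → u ^ Q ≈ e ^ (Q ∸ 1) * v
    σu₁≈v₁⇒condition eq = trans u^Q≈ (trans (*-congˡ eq) (sym e^[Q-1]v≈))

    K : Carrier → Carrier
    K b = κ + b * b + b

    -- Apart from `σ κ + κ`, the left side is `z² + z` at `z = σ a′ + a = σ b + b + t`. This
    -- additive expression kills `t` and commutes with `σ`.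
    σu₁+v₁≈σK+K : ∀ {b t} → t * t ≈ t → σ b + b ≈ σ a′ + a + t → σ u₁ + v₁ ≈ σ (K b) + K b
    σu₁+v₁≈σK+K {b} {t} t²≈t eq = begin
      σ u₁ + v₁
        ≈⟨ +-congʳ (trans (σ-+ _ κ) (+-congʳ (trans (σ-+ _ a′) (+-congʳ (trans (σ-+ 1# _) (+-cong σ-1 (σ-* a′ a′))))))) ⟩
      1# + σ a′ * σ a′ + σ a′ + σ κ + v₁
        ≈⟨ +-congʳ (+-congʳ (+-cong (+-congˡ (*-cong σa′≈ σa′≈)) σa′≈)) ⟩
      1# + (σ b + b + a + t) * (σ b + b + a + t) + (σ b + b + a + t) + σ κ + v₁
        ≈⟨ solve 6 (λ b σb a t κ σκ →
             con true :+ (σb :+ b :+ a :+ t) :* (σb :+ b :+ a :+ t) :+ (σb :+ b :+ a :+ t) :+ σκ :+ (con true :+ a :* a :+ a :+ κ)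
             := σκ :+ σb :* σb :+ σb :+ (κ :+ b :* b :+ b) :+ (t :* t :+ t)) refl b (σ b) a t κ (σ κ) ⟩
      σ κ + σ b * σ b + σ b + K b + (t * t + t)
        ≈⟨ trans (+-congˡ (x≈y⇒x+y≈0 t²≈t)) (+-identityʳ _) ⟩
      σ κ + σ b * σ b + σ b + K b
        ≈⟨ +-congʳ (trans (σ-+ _ b) (+-congʳ (trans (σ-+ κ _) (+-congˡ (σ-* b b))))) ⟨
      σ (K b) + K b ∎
      where
      σa′≈ : σ a′ ≈ σ b + b + a + t
      σa′≈ = trans (solve 3 (λ x a t → x := x :+ a :+ t :+ a :+ t) refl (σ a′) a t) (+-congʳ (+-congʳ (sym eq)))

    -- The symmetrised form vanishes on the diagonal, so in terms of `y` and `x + y` it has no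
    -- `norm y` term, just as the second component of `Φ` has no `norm x` term.
    R+R≈ : ∀ x y → R x y + R y x ≈ δ * (σ y * (x + y) + y * σ (x + y) + (1# + a + a′) * (σ (x + y) * (x + y)))
    R+R≈ x y = begin
      R x y + R y x
        ≈⟨ +-cong (R≈ x y) (R≈ y x) ⟩
      _
        ≈⟨ solve 7 (λ x σx y σy A σA B →
             (σx :+ (σA :+ con true) :* σy) :* (x :+ (A :+ con true) :* y) :+ B :* (σy :* y)
             :+ ((σy :+ (σA :+ con true) :* σx) :* (y :+ (A :+ con true) :* x) :+ B :* (σx :* x))
             := (σA :* A :+ B) :* (σy :* (x :+ y) :+ y :* (σx :+ σy) :+ (σx :+ σy) :* (x :+ y))
                :+ (A :+ σA) :* ((σx :+ σy) :* (x :+ y)))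
           refl x (σ x) y (σ y) A σA B ⟩
      δ * (σ y * (x + y) + y * (σ x + σ y) + (σ x + σ y) * (x + y)) + (A + σA) * ((σ x + σ y) * (x + y))
        ≈⟨ +-congˡ (*-congʳ (+-cong A≈aδ σA≈a′δ)) ⟩
      δ * (σ y * (x + y) + y * (σ x + σ y) + (σ x + σ y) * (x + y)) + (a * δ + a′ * δ) * ((σ x + σ y) * (x + y))
        ≈⟨ solve 6 (λ δ p s σs a a′ → δ :* (p :+ σs :* s) :+ (a :* δ :+ a′ :* δ) :* (σs :* s) := δ :* (p :+ (con true :+ a :+ a′) :* (σs :* s)))
             refl δ (σ y * (x + y) + y * (σ x + σ y)) (x + y) (σ x + σ y) a a′ ⟩
      δ * (σ y * (x + y) + y * (σ x + σ y) + (1# + a + a′) * ((σ x + σ y) * (x + y)))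
        ≈⟨ *-congˡ (+-cong (+-congˡ (*-congˡ (σ-+ x y))) (*-congˡ (*-congʳ (σ-+ x y)))) ⟨
      δ * (σ y * (x + y) + y * σ (x + y) + (1# + a + a′) * (σ (x + y) * (x + y))) ∎

    module _ {b} (σb+b≈σa′+a : σ b + b ≈ σ a′ + a) where

      -- Matching the `norm (x + y)` terms of `R+R≈` and `Φ` requires `σ ζ + ζ = a + a′`, which is
      -- solvable thanks to `b`. The summand 1 makes the multiplier in `R≈δ[Φ₁+bΦ₂]` equal to `b`
      -- rather than `b + 1`.
      ζ : Carrier
      ζ = 1# + a′ + b

      σζ : σ ζ ≈ 1# + a + b
      σζ = begin
        σ (1# + a′ + b)        ≈⟨ trans (σ-+ _ b) (+-congʳ (trans (σ-+ 1# a′) (+-congʳ σ-1))) ⟩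
        1# + σ a′ + σ b        ≈⟨ solve 3 (λ σa′ b σb → con true :+ σa′ :+ σb := con true :+ σa′ :+ (σb :+ b) :+ b) refl (σ a′) b (σ b) ⟩
        1# + σ a′ + (σ b + b) + b      ≈⟨ +-congʳ (+-congˡ σb+b≈σa′+a) ⟩
        1# + σ a′ + (σ a′ + a) + b     ≈⟨ solve 3 (λ σa′ a b → con true :+ σa′ :+ (σa′ :+ a) :+ b := con true :+ a :+ b) refl (σ a′) a b ⟩
        1# + a + b             ∎

      shear : Carrier × Carrier → Carrier × Carrier
      shear (x , y) = y + ζ * (x + y) , x + y

      unshear : Carrier × Carrier → Carrier × Carrier
      unshear (x , s) = s + (x + ζ * s) , x + ζ * s

      shear-cong : Congruent _≈²_ _≈²_ shear
      shear-cong (x≈ , y≈) = +-cong y≈ (*-congˡ (+-cong x≈ y≈)) , +-cong x≈ y≈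

      unshear-cong : Congruent _≈²_ _≈²_ unshear
      unshear-cong (x≈ , s≈) = +-cong s≈ (+-cong x≈ (*-congˡ s≈)) , +-cong x≈ (*-congˡ s≈)

      shear-unshear : ∀ p → shear (unshear p) ≈² p
      shear-unshear (x , s)
        = solve 3 (λ x s ζ → x :+ ζ :* s :+ ζ :* (s :+ (x :+ ζ :* s) :+ (x :+ ζ :* s)) := x) refl x s ζ
        , solve 3 (λ x s ζ → s :+ (x :+ ζ :* s) :+ (x :+ ζ :* s) := s) refl x s ζ

      unshear-shear : ∀ p → unshear (shear p) ≈² p
      unshear-shear (x , y)
        = solve 3 (λ x y ζ → x :+ y :+ (y :+ ζ :* (x :+ y) :+ ζ :* (x :+ y)) := x) refl x y ζ
        , solve 3 (λ x y ζ → y :+ ζ :* (x :+ y) :+ ζ :* (x :+ y) := y) refl x y ζ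

      Φ₁ Φ₂ : Carrier → Carrier → Carrier
      Φ₁ x y = proj₁ (Φ (K b) (shear (x , y)))
      Φ₂ x y = proj₂ (Φ (K b) (shear (x , y)))

      σ-shear : ∀ x y → σ (y + ζ * (x + y)) ≈ σ y + (1# + a + b) * (σ x + σ y)
      σ-shear x y = trans (σ-+ y _) (+-congˡ (trans (σ-* ζ _) (*-cong σζ (σ-+ x y))))

      R+R≈δΦ₂ : ∀ x y → R x y + R y x ≈ δ * Φ₂ x y
      R+R≈δΦ₂ x y = trans (R+R≈ x y) (*-congˡ (begin
        σ y * (x + y) + y * σ (x + y) + (1# + a + a′) * (σ (x + y) * (x + y))
          ≈⟨ solve 7 (λ y σy s σs a a′ b →
               σy :* s :+ y :* σs :+ (con true :+ a :+ a′) :* (σs :* s)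
               := (σy :+ (con true :+ a :+ b) :* σs) :* s :+ (y :+ (con true :+ a′ :+ b) :* s) :* σs :+ σs :* s)
             refl y (σ y) (x + y) (σ (x + y)) a a′ b ⟩
        (σ y + (1# + a + b) * σ (x + y)) * (x + y) + (y + ζ * (x + y)) * σ (x + y) + norm (x + y)
          ≈⟨ +-congʳ (+-congʳ (*-congʳ (trans (σ-shear x y) (+-congˡ (*-congˡ (sym (σ-+ x y))))))) ⟨
        Φ₂ x y ∎))

      R≈δ[Φ₁+bΦ₂] : ∀ x y → R y x ≈ δ * (Φ₁ x y + b * Φ₂ x y)
      R≈δ[Φ₁+bΦ₂] x y = begin
        R y x
          ≈⟨ R≈ y x ⟩
        _ ≈⟨ +-cong (*-cong (+-congˡ (*-congʳ (+-congʳ σA≈a′δ))) (+-congˡ (*-congʳ (+-congʳ A≈aδ)))) (*-congʳ B≈κδδ) ⟩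
        (σ y + (a′ * δ + 1#) * σ x) * (y + (a * δ + 1#) * x) + κ * δ * δ * (σ x * x)
          -- The last summand is the correction by a multiple of `δ * (a * a′ + κ) + 1#`, which is
          -- zero.
          ≈⟨ solve 9 (λ x σx y σy δ a a′ κ b →
               let s = x :+ y ; σs = σx :+ σy
                   X = y :+ (con true :+ a′ :+ b) :* s ; σX = σy :+ (con true :+ a :+ b) :* σs in
               (σy :+ (a′ :* δ :+ con true) :* σx) :* (y :+ (a :* δ :+ con true) :* x) :+ κ :* δ :* δ :* (σx :* x)
               := δ :* (σX :* X :+ (κ :+ b :* b :+ b) :* (σs :* s) :+ b :* (σX :* s :+ X :* σs :+ σs :* s))
                  :+ (δ :* (σx :* x) :+ σs :* s) :* (δ :* (a :* a′ :+ κ) :+ con true))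
             refl x (σ x) y (σ y) δ a a′ κ b ⟩
        _ ≈⟨ trans (+-congˡ (trans (*-congˡ (x≈y⇒x+y≈0 δ[aa′+κ]≈1)) (zeroʳ _))) (+-identityʳ _) ⟩
        _ ≈⟨ *-congˡ (+-cong (+-cong (*-congʳ (σ-shear x y)) (*-congˡ (*-congʳ (σ-+ x y))))
                             (*-congˡ (+-cong (+-cong (*-congʳ (σ-shear x y)) (*-congˡ (σ-+ x y))) (*-congʳ (σ-+ x y))))) ⟨
        δ * (Φ₁ x y + b * Φ₂ x y) ∎

      -- On the target side, `R y x` and `R x y + R y x` arise from `Φ₁` and `Φ₂` by a triangular
      -- linear map with diagonal entries `δ`, invertible as `δ` is nonzero.
      Φ-injective⇒ψ-injective : Injective _≈²_ _≈²_ (Φ (K b)) → Injective _≈²_ _≈²_ ψ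
      Φ-injective⇒ψ-injective inj {x , y} {x′ , y′} (eq₁ , eq₂) =
        trans (sym (proj₁ (unshear-shear (x , y)))) (trans (proj₁ unsheared) (proj₁ (unshear-shear (x′ , y′)))) ,
        trans (sym (proj₂ (unshear-shear (x , y)))) (trans (proj₂ unsheared) (proj₂ (unshear-shear (x′ , y′))))
        where
        Φ₂≈ : Φ₂ x y ≈ Φ₂ x′ y′
        Φ₂≈ = *-cancelˡ δ≉0 (trans (sym (R+R≈δΦ₂ x y)) (trans (+-cong eq₁ eq₂) (R+R≈δΦ₂ x′ y′)))
        Φ₁+bΦ₂≈ : Φ₁ x y + b * Φ₂ x y ≈ Φ₁ x′ y′ + b * Φ₂ x′ y′
        Φ₁+bΦ₂≈ = *-cancelˡ δ≉0 (trans (sym (R≈δ[Φ₁+bΦ₂] x y)) (trans eq₂ (R≈δ[Φ₁+bΦ₂] x′ y′)))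
        Φ₁≈ : Φ₁ x y ≈ Φ₁ x′ y′
        Φ₁≈ = trans (x≈x+y+y _ _) (trans (+-cong Φ₁+bΦ₂≈ (*-congˡ Φ₂≈)) (sym (x≈x+y+y _ _)))
        unsheared : unshear (shear (x , y)) ≈² unshear (shear (x′ , y′))
        unsheared = unshear-cong (inj (Φ₁≈ , Φ₂≈))

      ψ-injective⇒Φ-injective : Injective _≈²_ _≈²_ ψ → Injective _≈²_ _≈²_ (Φ (K b))
      ψ-injective⇒Φ-injective inj {p} {q} (eq₁ , eq₂) =
        trans (sym (proj₁ (shear-unshear p))) (trans (proj₁ sheared) (proj₁ (shear-unshear q))) ,
        trans (sym (proj₂ (shear-unshear p))) (trans (proj₂ sheared) (proj₂ (shear-unshear q)))
        where
        x y x′ y′ : Carrier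
        x  = proj₁ (unshear p)
        y  = proj₂ (unshear p)
        x′ = proj₁ (unshear q)
        y′ = proj₂ (unshear q)
        Φ-unshear : ∀ r → Φ (K b) (shear (unshear r)) ≈² Φ (K b) r
        Φ-unshear r = Φ-cong (shear-unshear r)
        Φ₁≈ : Φ₁ x y ≈ Φ₁ x′ y′
        Φ₁≈ = trans (proj₁ (Φ-unshear p)) (trans eq₁ (sym (proj₁ (Φ-unshear q))))
        Φ₂≈ : Φ₂ x y ≈ Φ₂ x′ y′
        Φ₂≈ = trans (proj₂ (Φ-unshear p)) (trans eq₂ (sym (proj₂ (Φ-unshear q))))
        Ryx≈ : R y x ≈ R y′ x′
        Ryx≈ = trans (R≈δ[Φ₁+bΦ₂] x y) (trans (*-congˡ (+-cong Φ₁≈ (*-congˡ Φ₂≈))) (sym (R≈δ[Φ₁+bΦ₂] x′ y′)))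
        Rxy≈ : R x y ≈ R x′ y′
        Rxy≈ = trans (x≈x+y+y _ (R y x)) (trans (+-cong (trans (R+R≈δΦ₂ x y) (trans (*-congˡ Φ₂≈) (sym (R+R≈δΦ₂ x′ y′)))) Ryx≈)
                     (sym (x≈x+y+y _ (R y′ x′))))
        sheared : shear (unshear p) ≈² shear (unshear q)
        sheared = shear-cong (inj (Rxy≈ , Ryx≈))

    -- The trace-one case, where both sides of the equivalence fail

    module _ {b} (σb+b≈σa′+a+1 : σ b + b ≈ σ a′ + a + 1#) where

      private
        -- A solution of `σ z + z = a + a′ + 1`, which is what `R+R≈` needs to vanish at
        -- `(z + 1# , z)`.
        z : Carrier
        z = b + a′

        σz≈ : σ z ≈ b + a + 1#
        σz≈ = begin
          σ (b + a′)               ≈⟨ σ-+ b a′ ⟩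
          σ b + σ a′               ≈⟨ solve 3 (λ b σb σa′ → σb :+ σa′ := (σb :+ b) :+ b :+ σa′) refl b (σ b) (σ a′) ⟩
          σ b + b + b + σ a′       ≈⟨ +-congʳ (+-congʳ σb+b≈σa′+a+1) ⟩
          σ a′ + a + 1# + b + σ a′ ≈⟨ solve 3 (λ σa′ a b → σa′ :+ a :+ con true :+ b :+ σa′ := b :+ a :+ con true) refl (σ a′) a b ⟩
          b + a + 1#               ∎

      -- y = z + A (z² + z + K) would satisfy σ y + y = 1.
      σK≉K : σ (K b) ≉ K b
      σK≉K σK≈K = σx+x≉1 (z + A * w) (begin
        σ (z + A * w) + (z + A * w)
          ≈⟨ +-congʳ (trans (σ-+ z _) (+-cong σz≈ (trans (σ-* A w) (*-cong (trans σ[α+1] σA≈a′δ) σw≈)))) ⟩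
        b + a + 1# + a′ * δ * (a * a + a + κ) + (b + a′ + A * w)
          ≈⟨ +-congˡ (+-congˡ (*-cong A≈aδ w≈)) ⟩
        b + a + 1# + a′ * δ * (a * a + a + κ) + (b + a′ + a * δ * (a′ * a′ + a′ + κ))
          -- The two products add up to `(a + a′) * δ * (a * a′ + κ)`, that is `a + a′`, and only 1
          -- survives.
          ≈⟨ solve 5 (λ a a′ b δ κ →
               b :+ a :+ con true :+ a′ :* δ :* (a :* a :+ a :+ κ) :+ (b :+ a′ :+ a :* δ :* (a′ :* a′ :+ a′ :+ κ))
               := con true :+ (a :+ a′) :* (δ :* (a :* a′ :+ κ) :+ con true)) refl a a′ b δ κ ⟩
        1# + (a + a′) * (δ * (a * a′ + κ) + 1#)
          ≈⟨ trans (+-congˡ (trans (*-congˡ (x≈y⇒x+y≈0 δ[aa′+κ]≈1)) (zeroʳ _))) (+-identityʳ 1#) ⟩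
        1# ∎)
        where
        w : Carrier
        w = z * z + z + K b
        w≈ : w ≈ a′ * a′ + a′ + κ
        w≈ = solve 3 (λ a′ b κ → (b :+ a′) :* (b :+ a′) :+ (b :+ a′) :+ (κ :+ b :* b :+ b) := a′ :* a′ :+ a′ :+ κ) refl a′ b κ
        σw≈ : σ w ≈ a * a + a + κ
        σw≈ = begin
          σ (z * z + z + K b)      ≈⟨ trans (σ-+ _ (K b)) (+-cong (trans (σ-+ _ z) (+-cong (trans (σ-* z z) (*-cong σz≈ σz≈)) σz≈)) σK≈K) ⟩
          (b + a + 1#) * (b + a + 1#) + (b + a + 1#) + K b
            ≈⟨ solve 3 (λ a b κ → (b :+ a :+ con true) :* (b :+ a :+ con true) :+ (b :+ a :+ con true) :+ (κ :+ b :* b :+ b) := a :* a :+ a :+ κ) refl a b κ ⟩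
          a * a + a + κ            ∎

      -- R (z + 1) z = R z (z + 1), and every value is attained by R on the diagonal.
      ψ-not-injective : ¬ Injective _≈²_ _≈²_ ψ
      ψ-not-injective inj = 1≉0 (begin
        1#            ≈⟨ solve 1 (λ z → con true := z :+ con true :+ z) refl z ⟩
        z + 1# + z    ≈⟨ x≈y⇒x+y≈0 (trans (proj₁ diagonal) (sym (proj₂ diagonal))) ⟩
        0#            ∎)
        where
        symmetric : R (z + 1#) z ≈ R z (z + 1#)
        symmetric = x+y≈0⇒x≈y (begin
          R (z + 1#) z + R z (z + 1#)
            ≈⟨ R+R≈ (z + 1#) z ⟩
          δ * (σ z * (z + 1# + z) + z * σ (z + 1# + z) + (1# + a + a′) * (σ (z + 1# + z) * (z + 1# + z)))
            ≈⟨ *-congˡ (+-cong (+-cong (*-cong σz≈ s≈1) (*-congˡ σs≈1)) (*-congˡ (*-cong σs≈1 s≈1))) ⟩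
          δ * ((b + a + 1#) * 1# + (b + a′) * 1# + (1# + a + a′) * (1# * 1#))
            ≈⟨ solve 4 (λ δ a a′ b → δ :* ((b :+ a :+ con true) :* con true :+ (b :+ a′) :* con true :+ (con true :+ a :+ a′) :* (con true :* con true)) := con false) refl δ a a′ b ⟩
          0# ∎)
          where
          s≈1 : z + 1# + z ≈ 1#
          s≈1 = solve 1 (λ z → z :+ con true :+ z := con true) refl z
          σs≈1 : σ (z + 1# + z) ≈ 1#
          σs≈1 = trans (σ-cong s≈1) σ-1

        -- Since `R y y = δ * norm y`, this root is the diagonal point with the prescribed value.
        root : ∃ λ y → norm y ≈ R z (z + 1#) * δ ⁻¹
        root = norm-surjective (R z (z + 1#) * δ ⁻¹)
        y₀ : Carrier
        y₀ = proj₁ root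
        R-diagonal : R z (z + 1#) ≈ R y₀ y₀
        R-diagonal = begin
          R z (z + 1#)      ≈⟨ *-quotient (R z (z + 1#)) δ≉0 ⟩
          R z (z + 1#) * δ ⁻¹ * δ      ≈⟨ *-congʳ (proj₂ root) ⟨
          norm y₀ * δ
            ≈⟨ solve 5 (λ y σy A σA B → σy :* y :* (σA :* A :+ B)
                 := (σy :+ (σA :+ con true) :* σy) :* (y :+ (A :+ con true) :* y) :+ B :* (σy :* y)) refl y₀ (σ y₀) A σA B ⟩
          _ ≈⟨ R≈ y₀ y₀ ⟨
          R y₀ y₀           ∎
        diagonal : (z + 1# , z) ≈² (y₀ , y₀)
        diagonal = inj (trans symmetric R-diagonal , R-diagonal)

  permutes⇔ : β ≉ 0# → Permutes² ψ ⇔ (β ≉ α + 1# × u ^ Q ≈ e ^ (Q ∸ 1) * v)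
  permutes⇔ β≉0 = mk⇔ (λ (inj , _) → necessary inj) λ (β≉α+1 , condition) →
    FiniteSetoid.Endofunction.bijective (×-setoid setoid setoid) pairs ψ-cong (sufficient (β≉α+1 ∘ δ≈0⇒β≈α+1) condition)
    where
    necessary : Injective _≈²_ _≈²_ ψ → β ≉ α + 1# × u ^ Q ≈ e ^ (Q ∸ 1) * v
    necessary inj = β≉α+1 , σu₁≈v₁⇒condition δ≉0 (by-cases (σb+b≈w∨w+1 (σ (a′ δ≉0) + a δ≉0)))
      where
      β≉α+1 : β ≉ α + 1#
      β≉α+1 β≈α+1 = β≈α+1⇒¬ψ-injective β≉0 β≈α+1 inj
      δ≉0 : δ ≉ 0#
      δ≉0 = β≉α+1 ∘ δ≈0⇒β≈α+1
      by-cases : (∃ λ b → σ b + b ≈ σ (a′ δ≉0) + a δ≉0 ⊎ σ b + b ≈ σ (a′ δ≉0) + a δ≉0 + 1#) → σ (u₁ δ≉0) ≈ v₁ δ≉0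
      by-cases (b , inj₂ eq) = ⊥-elim (ψ-not-injective δ≉0 eq inj)
      by-cases (b , inj₁ eq) = x+y≈0⇒x≈y (trans
        (σu₁+v₁≈σK+K δ≉0 (zeroʳ 0#) (trans eq (sym (+-identityʳ _))))
        (x≈y⇒x+y≈0 (f-injective⇒σκ≈κ (Φ-injective⇒f-injective (ψ-injective⇒Φ-injective δ≉0 eq inj)))))

    sufficient : δ ≉ 0# → u ^ Q ≈ e ^ (Q ∸ 1) * v → Injective _≈²_ _≈²_ ψ
    sufficient δ≉0 condition = by-cases (σb+b≈w∨w+1 (σ (a′ δ≉0) + a δ≉0))
      where
      -- Stated for both values of `t`: `t = 1` contradicts `σK≉K`, and `t = 0` supplies the
      -- hypothesis of `Φ-injective`.
      σK≈K : ∀ {b t} → t * t ≈ t → σ b + b ≈ σ (a′ δ≉0) + a δ≉0 + t → σ (K δ≉0 b) ≈ K δ≉0 b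
      σK≈K t²≈t eq = x+y≈0⇒x≈y (trans (sym (σu₁+v₁≈σK+K δ≉0 t²≈t eq)) (x≈y⇒x+y≈0 (condition⇒σu₁≈v₁ δ≉0 condition)))
      by-cases : (∃ λ b → σ b + b ≈ σ (a′ δ≉0) + a δ≉0 ⊎ σ b + b ≈ σ (a′ δ≉0) + a δ≉0 + 1#) → Injective _≈²_ _≈²_ ψ
      by-cases (b , inj₂ eq) = ⊥-elim (σK≉K δ≉0 eq (σK≈K (*-identityʳ 1#) eq))
      by-cases (b , inj₁ eq) = Φ-injective⇒ψ-injective δ≉0 eq
        (Φ-injective (σK≈K (zeroʳ 0#) (trans eq (sym (+-identityʳ _)))))

corollary9p6 :
    ∀ {c ℓ₁ ℓ₂ : Level} (k ℓ : ℕ) → 0 < k → 0 < ℓ → Coprime k ℓ → 2 ∤ k →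
    let q = 2 ℕ.^ k
        Q = 2 ℕ.^ ℓ
    in
    (F : HeytingField c ℓ₁ ℓ₂) →
    let open Field F in
    HasOrder q →
    (α β : Carrier) → α ≉ 0# → β ≉ 0# →
    Permutes² (ψ Q α β)
      ⇔ (β ≉ α + 1# × u Q α β ^ Q ≈ e Q α β ^ (Q ∸ 1) * v Q α β)
corollary9p6 k ℓ _ _ coprime 2∤k F order α β _ β≉0 with h , ≡.refl ← 2∤⇒odd k 2∤k =
  Butterfly.permutes⇔ F h ℓ order coprime α β β≉0
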